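{- For every positive integer $n$ and all nonnegative integers $a,b$, \[ \binom{an}{bn}_q \equiv \binom{a}{b}_{q^{n^2}} - (a-b)\,b\binom{a}{b}\frac{n^2-1}{24}(q^n-1)^2 \pmod{\Phi_n(q)^3}. \]
   Context: $[n]_q = 1+q+\cdots+q^{n-1}$, $[n]_q! = [n]_q\cdots[1]_q$, and $\binom{n}{k}_q = \frac{[n]_q!}{[k]_q![n-k]_q!}$ for $0\le k\le n$, with $\binom{n}{k}_q = 0$ if $k<0$ or $k>n$; $\binom{a}{b}_{q^{n^2}}$ is $\binom{a}{b}_q$ with $q$ replaced by $q^{n^2}$, and $\binom{a}{b}$ is the ordinary binomial coefficient. $\Phi_n(q)$ is the $n$th cyclotomic polynomial. A congruence $f\equiv g \pmod{\varphi(q)}$ means $f-g = h\varphi$ for some $h \in \mathbb{Q}[q^{\pm1}]$. -}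

module Defs where

open import Data.Nat as ℕ using (ℕ; zero; suc; _≤?_)
open import Data.Nat.Divisibility using (_∣?_)
open import Data.Nat.Combinatorics using (_C_)
open import Data.Integer as ℤ using (ℤ)
open import Data.Rational using (ℚ; 0ℚ; 1ℚ; _+_; _*_; -_; _/_)
open import Data.List using (List; []; _∷_; map; foldr; replicate; _++_; upTo; filter)
open import Data.Product using (Σ; ∃; _×_)
open import Relation.Binary.PropositionalEquality using (_≡_)
open import Relation.Nullary using (does)
open import Data.Bool using (if_then_else_)

-- Polynomials in q with rational coefficients, as coefficient lists
-- (lowest degree first).  Trailing zeros are allowed; equality of
-- polynomials is coefficientwise equality via 'coeff'.
Poly : Set
Poly = List ℚ

coeff : Poly → ℕ → ℚ
coeff []      _       = 0ℚ
coeff (c ∷ p) zero    = c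
coeff (c ∷ p) (suc i) = coeff p i

infixl 6 _⊕_ _⊖_
infixl 7 _⊛_

_⊕_ : Poly → Poly → Poly
[]      ⊕ q       = q
(x ∷ p) ⊕ []      = x ∷ p
(x ∷ p) ⊕ (y ∷ q) = (x + y) ∷ (p ⊕ q)

neg : Poly → Poly
neg = map -_

_⊖_ : Poly → Poly → Poly
p ⊖ q = p ⊕ neg q

const : ℚ → Poly
const c = c ∷ []

one : Poly
one = const 1ℚ

_⊛_ : Poly → Poly → Poly
[]      ⊛ q = []
(x ∷ p) ⊛ q = map (x *_) q ⊕ (0ℚ ∷ (p ⊛ q))

X^ : ℕ → Poly
X^ k = replicate k 0ℚ ++ (1ℚ ∷ [])

compose : Poly → Poly → Poly
compose p r = foldr (λ c acc → const c ⊕ (r ⊛ acc)) [] p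

prodP : List Poly → Poly
prodP = foldr _⊛_ one

-- Exact division a / b for b whose constant term b₀ is ±1 (so 1/b₀ = b₀),
-- by successive elimination of the lowest coefficient; 'fuel' bounds the
-- number of quotient coefficients.  Gives the true quotient whenever b
-- divides a and fuel ≥ length a.
head0 : Poly → ℚ
head0 []      = 0ℚ
head0 (c ∷ _) = c

tail0 : Poly → Poly
tail0 []      = []
tail0 (_ ∷ p) = p

lengthP : Poly → ℕ
lengthP []      = 0
lengthP (_ ∷ p) = suc (lengthP p)

divF : ℕ → Poly → Poly → Poly
divF zero    a b = []
divF (suc f) a b = c ∷ divF f (tail0 (a ⊖ map (c *_) b)) b
  where c = head0 a * head0 b

divExact : Poly → Poly → Poly
divExact a b = divF (lengthP a) a b

qint : ℕ → Poly
qint n = replicate n 1ℚ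

qfact : ℕ → Poly
qfact zero    = one
qfact (suc n) = qint (suc n) ⊛ qfact n

qbinom : ℕ → ℕ → Poly
qbinom n k = if does (k ≤? n)
             then divExact (qfact n) (qfact k ⊛ qfact (n ℕ.∸ k))
             else []

-- Cyclotomic polynomials, via  q^N - 1 = ∏_{d ∣ N} Φ_d(q):
-- Φ_N = (q^N - 1) / ∏_{d ∣ N, d < N} Φ_d.
-- cycTable m = [Φ_1, …, Φ_m].
nth : List Poly → ℕ → Poly
nth []      _       = []
nth (p ∷ _) zero    = p
nth (_ ∷ t) (suc i) = nth t i

cycTable : ℕ → List Poly
cycTable zero    = []
cycTable (suc m) =
  t ++ (divExact (X^ (suc m) ⊖ one)
                 (prodP (map (λ d → nth t (d ℕ.∸ 1))
                             (filter (_∣? suc m) (map suc (upTo m))))) ∷ [])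
  where t = cycTable m

Φ : ℕ → Poly
Φ n = nth (cycTable n) (n ℕ.∸ 1)

-- f ≡ g (mod m) in ℚ[q^{±1}]:  f - g = h·m with h a Laurent polynomial,
-- i.e. q^k (f - g) = h'·m for some k and polynomial h'.
_≡_[mod_] : Poly → Poly → Poly → Set
f ≡ g [mod m ] = Σ ℕ λ k → Σ Poly λ h →
  ∀ i → coeff (X^ k ⊛ (f ⊖ g)) i ≡ coeff (h ⊛ m) i

{-# OPTIONS --safe #-}

-- Write Φ for Φ_n.  By the q-Vandermonde identity the binomial of ((a+1)n, (b+1)n) is the sum of the two
-- terms of Pascal's rule in base q^(n²) and of the terms binom(n, j) binom(an, bn + n - j) q^… with
-- 0 < j < n.  There both factors are divisible by Φ, and the second one is (a - b) C(a, b) binom(n, n - j)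
-- modulo Φ², so by induction on a the error is (a - b) b C(a, b) W / 2 modulo Φ³, where W is the sum of
-- binom(n, j)² q^(j²) over 0 < j < n.  Since (1 - q^j) binom(n, j) = (1 - q^n) binom(n - 1, j - 1) and
-- binom(n - 1, j - 1)² ≡ q^(-j(j-1)) modulo Φ, W is (1 - q^n)² Σ q^j / (1 - q^j)² modulo Φ³.  An n-th root
-- of unity x ≠ 1 satisfies 2n x / (1 - x)² = Σ_{i<n} i (n - i) x^i, so that the last sum is -(n² - 1) / 12.
--
-- All this uses only that Φ divides q^n - 1 and is comaximal with q^k - 1 for 0 < k < n.  For g = gcd(k, n),
-- Φ divides (q^n - 1) / (q^g - 1), which is the unit n / g modulo q^g - 1, and q^g - 1 is a combination of
-- q^k - 1 and q^n - 1.  It follows that the Φ_d are pairwise comaximal, which in turn makes the division in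
-- the definition of Φ_n exact.
module Submission where

open import Algebra using (CommutativeRing; CommutativeSemigroup)
import Algebra.Properties.CommutativeSemigroup as CommutativeSemigroupProperties
open import Algebra.Solver.Ring.AlmostCommutativeRing using (_-Raw-AlmostCommutative⟶_; fromCommutativeRing)
import Algebra.Structures as Structures
open import Data.Bool using (if_then_else_; true; false)
open import Data.Integer as ℤ using (ℤ; +_; -[1+_])
import Data.Integer.Properties as ℤₚ
open import Data.Integer.Solver using (module +-*-Solver)
open import Data.List using (List; []; _∷_; _++_; map; length; filter; upTo)
import Data.List.Properties as Listₚ
open import Data.Maybe using (Maybe; just; nothing)
open import Data.Nat as ℕ using (ℕ; zero; suc; z≤n; s≤s; _∸_)
open import Data.Nat.Combinatorics using (_C_; nCk+nC[k+1]≡[n+1]C[k+1]; nCk≡nC[n∸k]; nCn≡1; nC1≡n; k>n⇒nCk≡0)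
import Data.Nat.Divisibility as ℕ∣
open import Data.Nat.GCD using (gcd; gcd[m,n]∣m; gcd[m,n]∣n; gcd-GCD; module Bézout)
import Data.Nat.Properties as ℕₚ
open import Data.Product using (∃; ∃₂; _,_; proj₁; proj₂)
open import Data.Rational as ℚ using (ℚ; 0ℚ; 1ℚ)
import Data.Rational.Properties as ℚₚ
open import Data.Rational.Unnormalised as ℚᵘ using (mkℚᵘ; *≡*)
import Data.Rational.Unnormalised.Properties as ℚᵘₚ
open import Data.Sum using (_⊎_; inj₁; inj₂)
open import Level using (0ℓ)
open import Relation.Binary using (IsEquivalence; Setoid)
import Relation.Binary.PropositionalEquality as P
open P using (_≡_; _≢_)
open import Relation.Nullary using (¬_; Dec; yes; no; does; contradiction)
open import Relation.Nullary.Decidable using (dec-true; dec-false)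
open import Relation.Unary using (Pred; Decidable)

-- A power of q^n is 1 only modulo Φ. It can be erased from a term that already carries two factors
-- Φ, but not from the main term, and what stays there is Pascal's coefficient in base q^(n²), since
-- n (n + bn) = n² (b + 1). This is where the base q^(n²) comes from. The halving of W comes from
-- the recursion of e(a, b) = (a - b) b C(a, b), which is e(a + 1, b + 1) = e(a, b + 1) + 2 (a - b)
-- C(a, b) + e(a, b).
--
-- Quotients by 1 - q^j and sums over roots of unity have no direct meaning for polynomials. The
-- former become inverses modulo Φ, and the precision lost with them is regained from a factor Φ
-- standing next to them; the latter become sums over powers of q itself. All this is carried out in
-- an arbitrary commutative ring, and rational polynomials enter only at the end.
--
-- Comaximality of the Φ_d and exactness of the divisions that define them depend on each other, so
-- that both are obtained in a single induction on d.

-- (b + 1) (a C (b + 1)) is (a - b) (a C b) without the subtraction.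
linearWeight : ℕ → ℕ → ℕ
linearWeight a b = suc b ℕ.* (a C suc b)

-- The factor (a - b) b C(a, b) of the error term, as a natural number so that `ι` can map it into
-- any ring.
quadraticWeight : ℕ → ℕ → ℕ
quadraticWeight a b = b ℕ.* linearWeight a b

nC0≡1 : ∀ a → a C 0 ≡ 1
nC0≡1 a = P.trans (nCk≡nC[n∸k] {0} {a} z≤n) (nCn≡1 a)

0C[1+b]≡0 : ∀ b → 0 C suc b ≡ 0
0C[1+b]≡0 b = k>n⇒nCk≡0 {0} {suc b} (s≤s z≤n)

-- The absorption identity for binomial coefficients. It is stated in ℤ because a - b is negative
-- for a < b, where both binomials vanish. Pascal's rule reduces it to the pairs (a, b) and (a, b +
-- 1).
linearWeight-ℤ : ∀ a b → (+ a ℤ.- + b) ℤ.* + (a C b) ≡ + linearWeight a b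
linearWeight-ℤ zero zero = P.refl
linearWeight-ℤ zero (suc b) = P.trans
  (P.trans (P.cong (λ c → (+ 0 ℤ.- + suc b) ℤ.* + c) (0C[1+b]≡0 b)) (ℤₚ.*-zeroʳ (+ 0 ℤ.- + suc b)))
  (P.cong +_ (P.sym (P.trans (P.cong (suc (suc b) ℕ.*_) (0C[1+b]≡0 (suc b))) (ℕₚ.*-zeroʳ (suc (suc b))))))
linearWeight-ℤ (suc a) zero = begin
  (+ suc a ℤ.- + 0) ℤ.* + (suc a C 0)   ≡⟨ P.cong₂ ℤ._*_ (ℤₚ.+-identityʳ (+ suc a)) (P.cong +_ (nC0≡1 (suc a))) ⟩
  + suc a ℤ.* + 1                       ≡⟨ ℤₚ.*-identityʳ (+ suc a) ⟩
  + suc a                               ≡⟨ P.cong +_ (P.trans (ℕₚ.*-identityˡ _) (nC1≡n (suc a))) ⟨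
  + linearWeight (suc a) 0              ∎
  where open P.≡-Reasoning
linearWeight-ℤ (suc a) (suc b) = begin
  (+ suc a ℤ.- + suc b) ℤ.* + (suc a C suc b)
    ≡⟨ P.cong (λ c → (+ suc a ℤ.- + suc b) ℤ.* + c) (P.sym (nCk+nC[k+1]≡[n+1]C[k+1] a b)) ⟩
  (+ 1 ℤ.+ A ℤ.- (+ 1 ℤ.+ B)) ℤ.* (C₀ ℤ.+ C₁)
    ≡⟨ solve 4 (λ A B C₀ C₁ → (con (+ 1) :+ A :- (con (+ 1) :+ B)) :* (C₀ :+ C₁)
          := (A :- B) :* C₀ :+ ((A :- (con (+ 1) :+ B)) :* C₁ :+ C₁)) P.refl A B C₀ C₁ ⟩
  (A ℤ.- B) ℤ.* C₀ ℤ.+ ((A ℤ.- + suc b) ℤ.* C₁ ℤ.+ C₁)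
    ≡⟨ P.cong₂ (λ x y → x ℤ.+ (y ℤ.+ C₁)) (P.trans (linearWeight-ℤ a b) (ℤₚ.pos-* (suc b) (a C suc b)))
                                          (P.trans (linearWeight-ℤ a (suc b)) (ℤₚ.pos-* (suc (suc b)) (a C suc (suc b)))) ⟩
  (+ 1 ℤ.+ B) ℤ.* C₁ ℤ.+ ((+ 1 ℤ.+ (+ 1 ℤ.+ B)) ℤ.* C₂ ℤ.+ C₁)
    ≡⟨ solve 3 (λ B C₁ C₂ → (con (+ 1) :+ B) :* C₁ :+ ((con (+ 1) :+ (con (+ 1) :+ B)) :* C₂ :+ C₁)
          := (con (+ 1) :+ (con (+ 1) :+ B)) :* (C₁ :+ C₂)) P.refl B C₁ C₂ ⟩
  + suc (suc b) ℤ.* + ((a C suc b) ℕ.+ (a C suc (suc b)))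
    ≡⟨ P.cong (λ c → + suc (suc b) ℤ.* + c) (nCk+nC[k+1]≡[n+1]C[k+1] a (suc b)) ⟩
  + suc (suc b) ℤ.* + (suc a C suc (suc b))
    ≡⟨ ℤₚ.pos-* (suc (suc b)) (suc a C suc (suc b)) ⟨
  + linearWeight (suc a) (suc b) ∎
  where
  open P.≡-Reasoning
  open +-*-Solver
  A B C₀ C₁ C₂ : ℤ
  A = + a
  B = + b
  C₀ = + (a C b)
  C₁ = + (a C suc b)
  C₂ = + (a C suc (suc b))

quadraticWeight-ℤ : ∀ a b → (+ a ℤ.- + b) ℤ.* + b ℤ.* + (a C b) ≡ + quadraticWeight a b
quadraticWeight-ℤ a b = begin
  (+ a ℤ.- + b) ℤ.* + b ℤ.* + (a C b)
    ≡⟨ solve 3 (λ x b c → x :* b :* c := b :* (x :* c)) P.refl (+ a ℤ.- + b) (+ b) (+ (a C b)) ⟩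
  + b ℤ.* ((+ a ℤ.- + b) ℤ.* + (a C b))   ≡⟨ P.cong (+ b ℤ.*_) (linearWeight-ℤ a b) ⟩
  + b ℤ.* + linearWeight a b              ≡⟨ ℤₚ.pos-* b (linearWeight a b) ⟨
  + quadraticWeight a b                   ∎
  where
  open P.≡-Reasoning
  open +-*-Solver

-- A ring solver with integer coefficients over any commutative ring

module IntegerSolver (R : CommutativeRing 0ℓ 0ℓ) where

  open CommutativeRing R
  open import Algebra.Properties.Ring ring
  open import Algebra.Properties.Semiring.Mult.TCOptimised semiring
  open import Relation.Binary.Reasoning.Setoid setoid

  -- A numeral becomes the same multiple of `1#` that `ι` denotes later, so that `con (+ 12)` in a
  -- solver call is literally `ι 12`. The optimised multiple sends 1 to `1#` itself.
  ⟦_⟧ℤ : ℤ → Carrier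
  ⟦ + n ⟧ℤ = n × 1#
  ⟦ -[1+ n ] ⟧ℤ = - (suc n × 1#)

  private
    suc× : ∀ n → suc n × 1# ≈ 1# + n × 1#
    suc× n = ×-homo-+ 1# 1 n

    cancel : ∀ x y → (1# + x) + - (1# + y) ≈ x + - y
    cancel x y = begin
      (1# + x) + - (1# + y)     ≈⟨ +-cong (+-comm 1# x) (sym (-‿+-comm 1# y)) ⟩
      (x + 1#) + (- 1# + - y)   ≈⟨ +-assoc x 1# _ ⟩
      x + (1# + (- 1# + - y))   ≈⟨ +-congˡ (+-assoc 1# (- 1#) (- y)) ⟨
      x + ((1# + - 1#) + - y)   ≈⟨ +-congˡ (+-congʳ (-‿inverseʳ 1#)) ⟩
      x + (0# + - y)            ≈⟨ +-congˡ (+-identityˡ (- y)) ⟩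
      x + - y                   ∎

    ⊖-homo : ∀ m n → ⟦ m ℤ.⊖ n ⟧ℤ ≈ m × 1# + - (n × 1#)
    ⊖-homo m zero = sym (trans (+-congˡ -0#≈0#) (+-identityʳ _))
    ⊖-homo zero (suc n) = sym (+-identityˡ _)
    ⊖-homo (suc m) (suc n) = begin
      ⟦ suc m ℤ.⊖ suc n ⟧ℤ              ≡⟨ P.cong ⟦_⟧ℤ (ℤₚ.[1+m]⊖[1+n]≡m⊖n m n) ⟩
      ⟦ m ℤ.⊖ n ⟧ℤ                      ≈⟨ ⊖-homo m n ⟩
      m × 1# + - (n × 1#)               ≈⟨ cancel _ _ ⟨
      (1# + m × 1#) + - (1# + n × 1#)   ≈⟨ +-cong (suc× m) (-‿cong (suc× n)) ⟨
      suc m × 1# + - (suc n × 1#)       ∎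

    +-homo : ∀ x y → ⟦ x ℤ.+ y ⟧ℤ ≈ ⟦ x ⟧ℤ + ⟦ y ⟧ℤ
    +-homo (+ m) (+ n) = ×-homo-+ 1# m n
    +-homo (+ m) -[1+ n ] = ⊖-homo m (suc n)
    +-homo -[1+ m ] (+ n) = trans (⊖-homo n (suc m)) (+-comm _ _)
    +-homo -[1+ m ] -[1+ n ] = begin
      - (suc (suc (m ℕ.+ n)) × 1#)      ≡⟨ P.cong (λ t → - (t × 1#)) (P.cong suc (ℕₚ.+-suc m n)) ⟨
      - ((suc m ℕ.+ suc n) × 1#)        ≈⟨ -‿cong (×-homo-+ 1# (suc m) (suc n)) ⟩
      - (suc m × 1# + suc n × 1#)       ≈⟨ -‿+-comm _ _ ⟨
      - (suc m × 1#) + - (suc n × 1#)   ∎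

    neg-homo : ∀ x → ⟦ ℤ.- x ⟧ℤ ≈ - ⟦ x ⟧ℤ
    neg-homo (+ zero) = sym -0#≈0#
    neg-homo (+ suc n) = refl
    neg-homo -[1+ n ] = sym (-‿involutive _)

    pos-homo : ∀ m n → ⟦ + m ℤ.* + n ⟧ℤ ≈ ⟦ + m ⟧ℤ * ⟦ + n ⟧ℤ
    pos-homo m n = trans (reflexive (P.cong ⟦_⟧ℤ (P.sym (ℤₚ.pos-* m n)))) (×1-homo-* m n)

    *-homo : ∀ x y → ⟦ x ℤ.* y ⟧ℤ ≈ ⟦ x ⟧ℤ * ⟦ y ⟧ℤ
    *-homo (+ m) (+ n) = pos-homo m n
    *-homo (+ m) -[1+ n ] = begin
      ⟦ + m ℤ.* -[1+ n ] ⟧ℤ          ≡⟨ P.cong ⟦_⟧ℤ (ℤₚ.neg-distribʳ-* (+ m) (+ suc n)) ⟨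
      ⟦ ℤ.- (+ m ℤ.* + suc n) ⟧ℤ     ≈⟨ neg-homo (+ m ℤ.* + suc n) ⟩
      - ⟦ + m ℤ.* + suc n ⟧ℤ         ≈⟨ -‿cong (pos-homo m (suc n)) ⟩
      - (m × 1# * suc n × 1#)        ≈⟨ -‿distribʳ-* _ _ ⟩
      m × 1# * - (suc n × 1#)        ∎
    *-homo -[1+ m ] (+ n) = begin
      ⟦ -[1+ m ] ℤ.* + n ⟧ℤ          ≡⟨ P.cong ⟦_⟧ℤ (ℤₚ.neg-distribˡ-* (+ suc m) (+ n)) ⟨
      ⟦ ℤ.- (+ suc m ℤ.* + n) ⟧ℤ     ≈⟨ neg-homo (+ suc m ℤ.* + n) ⟩
      - ⟦ + suc m ℤ.* + n ⟧ℤ         ≈⟨ -‿cong (pos-homo (suc m) n) ⟩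
      - (suc m × 1# * n × 1#)        ≈⟨ -‿distribˡ-* _ _ ⟩
      - (suc m × 1#) * n × 1#        ∎
    *-homo -[1+ m ] -[1+ n ] = begin
      ⟦ + suc m ℤ.* + suc n ⟧ℤ           ≈⟨ pos-homo (suc m) (suc n) ⟩
      suc m × 1# * suc n × 1#            ≈⟨ -‿involutive _ ⟨
      - - (suc m × 1# * suc n × 1#)      ≈⟨ -‿cong (-‿distribˡ-* _ _) ⟩
      - (- (suc m × 1#) * suc n × 1#)    ≈⟨ -‿distribʳ-* _ _ ⟩
      - (suc m × 1#) * - (suc n × 1#)    ∎

    morphism : CommutativeRing.rawRing ℤₚ.+-*-commutativeRing
               -Raw-AlmostCommutative⟶ fromCommutativeRing R
    morphism = record
      { ⟦_⟧ = ⟦_⟧ℤ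
      ; +-homo = +-homo
      ; *-homo = *-homo
      ; -‿homo = neg-homo
      ; 0-homo = refl
      ; 1-homo = refl
      }

    dec : ∀ x y → Maybe (⟦ x ⟧ℤ ≈ ⟦ y ⟧ℤ)
    dec x y with x ℤₚ.≟ y
    ... | yes P.refl = just refl
    ... | no _ = nothing

  open import Algebra.Solver.Ring _ _ morphism dec public
    using (solve; _:=_; _:+_; _:*_; _:-_; :-_; con)

-- Finite sums and Gaussian binomial coefficients

module GaussianBinomials (R : CommutativeRing 0ℓ 0ℓ) where

  open CommutativeRing R hiding (zero)
  open import Algebra.Properties.CommutativeSemiring.Exp commutativeSemiring
  open import Algebra.Properties.Semiring.Mult.TCOptimised semiring using (_×_; ×-homo-+; ×1-homo-*)
  open import Relation.Binary.Reasoning.Setoid setoid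
  open IntegerSolver R

  ι : ℕ → Carrier
  ι n = n × 1#

  ι-suc : ∀ n → ι (suc n) ≈ 1# + ι n
  ι-suc n = ×-homo-+ 1# 1 n

  ι-+ : ∀ m n → ι (m ℕ.+ n) ≈ ι m + ι n
  ι-+ = ×-homo-+ 1#

  ι-* : ∀ m n → ι (m ℕ.* n) ≈ ι m * ι n
  ι-* = ×1-homo-*

  x≈y⇒x-y≈0 : ∀ {x y} → x ≈ y → x - y ≈ 0#
  x≈y⇒x-y≈0 {x} {y} x≈y = trans (+-congʳ x≈y) (-‿inverseʳ y)

  0*x*y≈0 : ∀ {z} x y → z ≈ 0# → z * x * y ≈ 0#
  0*x*y≈0 x y z≈0 = trans (*-congʳ (trans (*-congʳ z≈0) (zeroˡ x))) (zeroˡ y)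

  ∑ : ℕ → (ℕ → Carrier) → Carrier
  ∑ zero f = 0#
  ∑ (suc n) f = ∑ n f + f n

  ∑-cong : ∀ n {f g : ℕ → Carrier} → (∀ i → i ℕ.< n → f i ≈ g i) → ∑ n f ≈ ∑ n g
  ∑-cong zero f≈g = refl
  ∑-cong (suc n) f≈g = +-cong (∑-cong n λ i i<n → f≈g i (ℕₚ.m<n⇒m<1+n i<n)) (f≈g n ℕₚ.≤-refl)

  ∑-zero : ∀ n {f : ℕ → Carrier} → (∀ i → i ℕ.< n → f i ≈ 0#) → ∑ n f ≈ 0#
  ∑-zero zero f≈0 = refl
  ∑-zero (suc n) f≈0 =
    trans (+-cong (∑-zero n λ i i<n → f≈0 i (ℕₚ.m<n⇒m<1+n i<n)) (f≈0 n ℕₚ.≤-refl)) (+-identityˡ 0#)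

  ∑-distrib-+ : ∀ n (f g : ℕ → Carrier) → ∑ n (λ i → f i + g i) ≈ ∑ n f + ∑ n g
  ∑-distrib-+ zero f g = sym (+-identityˡ 0#)
  ∑-distrib-+ (suc n) f g = begin
    ∑ n (λ i → f i + g i) + (f n + g n)   ≈⟨ +-congʳ (∑-distrib-+ n f g) ⟩
    (∑ n f + ∑ n g) + (f n + g n)
      ≈⟨ solve 4 (λ a b c d → (a :+ b) :+ (c :+ d) := (a :+ c) :+ (b :+ d)) refl _ _ _ _ ⟩
    (∑ n f + f n) + (∑ n g + g n)         ∎

  *-distribˡ-∑ : ∀ n c (f : ℕ → Carrier) → c * ∑ n f ≈ ∑ n (λ i → c * f i)
  *-distribˡ-∑ zero c f = zeroʳ c
  *-distribˡ-∑ (suc n) c f = trans (distribˡ c _ _) (+-congʳ (*-distribˡ-∑ n c f))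

  ∑-head : ∀ n (f : ℕ → Carrier) → ∑ (suc n) f ≈ f 0 + ∑ n (λ i → f (suc i))
  ∑-head zero f = +-comm 0# (f 0)
  ∑-head (suc n) f = trans (+-congʳ (∑-head n f)) (+-assoc _ _ _)

  ∑-split : ∀ m n (f : ℕ → Carrier) → ∑ (m ℕ.+ n) f ≈ ∑ m f + ∑ n (λ i → f (m ℕ.+ i))
  ∑-split m zero f rewrite ℕₚ.+-identityʳ m = sym (+-identityʳ _)
  ∑-split m (suc n) f rewrite ℕₚ.+-suc m n = trans (+-congʳ (∑-split m n f)) (+-assoc _ _ _)

  ∑-swap : ∀ m n (f : ℕ → ℕ → Carrier) → ∑ m (λ i → ∑ n (f i)) ≈ ∑ n (λ j → ∑ m (λ i → f i j))
  ∑-swap zero n f = sym (∑-zero n λ _ _ → refl)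
  ∑-swap (suc m) n f = trans (+-congʳ (∑-swap m n f)) (sym (∑-distrib-+ n _ _))

  -- Pascal's rule replaces the quotient of factorials: it is free of division and makes sense for
  -- every base in every commutative ring, which is needed at `q` and at `q ^ (n * n)`.
  G : Carrier → ℕ → ℕ → Carrier
  G q _ zero = 1#
  G q zero (suc k) = 0#
  G q (suc n) (suc k) = G q n k + q ^ suc k * G q n (suc k)

  module _ (q : Carrier) where

    n<k⇒G≈0 : ∀ {n k} → n ℕ.< k → G q n k ≈ 0#
    n<k⇒G≈0 {zero} {suc k} n<k = refl
    n<k⇒G≈0 {suc n} {suc k} (s≤s n<k) = begin
      G q n k + q ^ suc k * G q n (suc k)
        ≈⟨ +-cong (n<k⇒G≈0 n<k) (*-congˡ (n<k⇒G≈0 (ℕₚ.m<n⇒m<1+n n<k))) ⟩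
      0# + q ^ suc k * 0#   ≈⟨ trans (+-identityˡ _) (zeroʳ _) ⟩
      0#                    ∎

    G-self : ∀ n → G q n n ≈ 1#
    G-self zero = refl
    G-self (suc n) = begin
      G q n n + q ^ suc n * G q n (suc n)
        ≈⟨ +-cong (G-self n) (*-congˡ (n<k⇒G≈0 {n} ℕₚ.≤-refl)) ⟩
      1# + q ^ suc n * 0#   ≈⟨ trans (+-congˡ (zeroʳ _)) (+-identityʳ _) ⟩
      1#                    ∎

    -- The mirror image of the defining rule. Writing the upper index as `i + j` turns the exponent
    -- n - k into the variable `j`. The two rules together yield `G-sym`.
    G-pascal′ : ∀ i j → G q (suc (i ℕ.+ j)) (suc i) ≈ q ^ j * G q (i ℕ.+ j) i + G q (i ℕ.+ j) (suc i)
    G-pascal′ zero zero =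
      solve 1 (λ q → con (+ 1) :+ (q :* con (+ 1)) :* con (+ 0) := con (+ 1) :* con (+ 1) :+ con (+ 0)) refl q
    G-pascal′ zero (suc j) = begin
      1# + q ^ 1 * G q (suc j) 1    ≈⟨ +-congˡ (*-congˡ (G-pascal′ zero j)) ⟩
      1# + q ^ 1 * (q ^ j * 1# + G q j 1)
        ≈⟨ solve 3 (λ q p g → con (+ 1) :+ (q :* con (+ 1)) :* (p :* con (+ 1) :+ g)
                    := (q :* p) :* con (+ 1) :+ (con (+ 1) :+ (q :* con (+ 1)) :* g)) refl q (q ^ j) (G q j 1) ⟩
      q ^ suc j * 1# + (1# + q ^ 1 * G q j 1) ∎
    G-pascal′ (suc i) zero rewrite ℕₚ.+-identityʳ i = begin
      G q (suc i) (suc i) + q ^ suc (suc i) * G q (suc i) (suc (suc i))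
        ≈⟨ +-congˡ (trans (*-congˡ 0≈) (zeroʳ _)) ⟩
      G q (suc i) (suc i) + 0#    ≈⟨ +-cong (sym (*-identityˡ _)) (sym 0≈) ⟩
      1# * G q (suc i) (suc i) + G q (suc i) (suc (suc i)) ∎
      where
      0≈ : G q (suc i) (suc (suc i)) ≈ 0#
      0≈ = n<k⇒G≈0 {suc i} ℕₚ.≤-refl
    G-pascal′ (suc i) (suc j) = begin
      G q (suc (i ℕ.+ suc j)) (suc i) + q ^ suc (suc i) * G q (suc (i ℕ.+ suc j)) (suc (suc i))
        ≈⟨ +-cong (G-pascal′ i (suc j)) (*-congˡ ih) ⟩
      (q ^ suc j * G q (i ℕ.+ suc j) i + G q (i ℕ.+ suc j) (suc i))
        + q ^ suc (suc i) * (q ^ j * G q (i ℕ.+ suc j) (suc i) + G q (i ℕ.+ suc j) (suc (suc i)))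
        ≈⟨ solve 6 (λ q p r x y z → ((q :* p) :* x :+ y) :+ (q :* (q :* r)) :* (p :* y :+ z)
                    := (q :* p) :* (x :+ (q :* r) :* y) :+ (y :+ (q :* (q :* r)) :* z)) refl
             q (q ^ j) (q ^ i) (G q (i ℕ.+ suc j) i) (G q (i ℕ.+ suc j) (suc i)) (G q (i ℕ.+ suc j) (suc (suc i))) ⟩
      q ^ suc j * (G q (i ℕ.+ suc j) i + q ^ suc i * G q (i ℕ.+ suc j) (suc i))
        + (G q (i ℕ.+ suc j) (suc i) + q ^ suc (suc i) * G q (i ℕ.+ suc j) (suc (suc i))) ∎
      where
      ih : G q (suc (i ℕ.+ suc j)) (suc (suc i))
           ≈ q ^ j * G q (i ℕ.+ suc j) (suc i) + G q (i ℕ.+ suc j) (suc (suc i))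
      ih = P.subst (λ m → G q (suc m) (suc (suc i)) ≈ q ^ j * G q m (suc i) + G q m (suc (suc i)))
                   (P.sym (ℕₚ.+-suc i j)) (G-pascal′ (suc i) j)

    G-sym : ∀ i j → G q (i ℕ.+ j) i ≈ G q (i ℕ.+ j) j
    G-sym zero j = sym (G-self j)
    G-sym (suc i) zero rewrite ℕₚ.+-identityʳ i = G-self (suc i)
    G-sym (suc i) (suc j) = begin
      G q (suc (i ℕ.+ suc j)) (suc i)
        ≈⟨ G-pascal′ i (suc j) ⟩
      q ^ suc j * G q (i ℕ.+ suc j) i + G q (i ℕ.+ suc j) (suc i)
        ≈⟨ +-cong (*-congˡ (G-sym i (suc j))) ih ⟩
      q ^ suc j * G q (i ℕ.+ suc j) (suc j) + G q (i ℕ.+ suc j) j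
        ≈⟨ +-comm _ _ ⟩
      G q (suc (i ℕ.+ suc j)) (suc j) ∎
      where
      ih : G q (i ℕ.+ suc j) (suc i) ≈ G q (i ℕ.+ suc j) j
      ih = P.subst (λ m → G q m (suc i) ≈ G q m j) (P.sym (ℕₚ.+-suc i j)) (G-sym (suc i) j)

    -- The powers of q on both sides avoid the exponent n − k, which is truncated when k > n.
    G-ratio : ∀ n k → q ^ k * ((1# - q ^ suc k) * G q n (suc k)) ≈ (q ^ k - q ^ n) * G q n k
    G-absorb : ∀ n k → (1# - q ^ suc k) * G q (suc n) (suc k) ≈ (1# - q ^ suc n) * G q n k

    G-ratio zero zero = solve 1 (λ p → con (+ 1) :* ((con (+ 1) :- p) :* con (+ 0))
                                  := (con (+ 1) :- con (+ 1)) :* con (+ 1)) refl (q ^ 1)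
    G-ratio zero (suc k) = solve 2 (λ p r → p :* ((con (+ 1) :- r) :* con (+ 0))
                                  := (p :- con (+ 1)) :* con (+ 0)) refl (q ^ suc k) (q ^ suc (suc k))
    G-ratio (suc n) zero = trans (*-identityˡ _) (G-absorb n zero)
    G-ratio (suc n) (suc k) = begin
      q ^ suc k * ((1# - q ^ suc (suc k)) * G q (suc n) (suc (suc k)))
        ≈⟨ *-congˡ (G-absorb n (suc k)) ⟩
      q ^ suc k * ((1# - q ^ suc n) * G q n (suc k))
        ≈⟨ solve 4 (λ q p r x → (q :* p) :* ((con (+ 1) :- q :* r) :* x)
             := q :* (p :* ((con (+ 1) :- q :* p) :* x)) :+ (q :* p :- q :* r) :* ((q :* p) :* x)) refl
             q (q ^ k) (q ^ n) (G q n (suc k)) ⟩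
      q * (q ^ k * ((1# - q ^ suc k) * G q n (suc k)))
        + (q ^ suc k - q ^ suc n) * (q ^ suc k * G q n (suc k))
        ≈⟨ +-congʳ (*-congˡ (G-ratio n k)) ⟩
      q * ((q ^ k - q ^ n) * G q n k) + (q ^ suc k - q ^ suc n) * (q ^ suc k * G q n (suc k))
        ≈⟨ solve 5 (λ q p r x y → q :* ((p :- r) :* x) :+ (q :* p :- q :* r) :* y
             := (q :* p :- q :* r) :* (x :+ y)) refl q (q ^ k) (q ^ n) (G q n k) (q ^ suc k * G q n (suc k)) ⟩
      (q ^ suc k - q ^ suc n) * (G q n k + q ^ suc k * G q n (suc k)) ∎

    G-absorb n k = begin
      (1# - q ^ suc k) * (G q n k + q ^ suc k * G q n (suc k))
        ≈⟨ solve 4 (λ q p x y → (con (+ 1) :- q :* p) :* (x :+ (q :* p) :* y)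
             := (con (+ 1) :- q :* p) :* x :+ q :* (p :* ((con (+ 1) :- q :* p) :* y))) refl
             q (q ^ k) (G q n k) (G q n (suc k)) ⟩
      (1# - q ^ suc k) * G q n k + q * (q ^ k * ((1# - q ^ suc k) * G q n (suc k)))
        ≈⟨ +-congˡ (*-congˡ (G-ratio n k)) ⟩
      (1# - q ^ suc k) * G q n k + q * ((q ^ k - q ^ n) * G q n k)
        ≈⟨ solve 4 (λ q p r x → (con (+ 1) :- q :* p) :* x :+ q :* ((p :- r) :* x)
             := (con (+ 1) :- q :* r) :* x) refl q (q ^ k) (q ^ n) (G q n k) ⟩
      (1# - q ^ suc n) * G q n k ∎

    -- Induction on `n`: Pascal's rule produces two Vandermonde sums, and after a shift of the
    -- second by one they merge term by term. Truncation of `n ∸ j` does no harm, because `G q n j`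
    -- vanishes for j > n.
    vandermonde : ∀ n m r →
      G q (n ℕ.+ m) r ≈ ∑ (suc r) (λ j → G q n j * G q m (r ∸ j) * q ^ ((n ∸ j) ℕ.* (r ∸ j)))
    vandermonde zero m r = sym (begin
      ∑ (suc r) (λ j → G q 0 j * G q m (r ∸ j) * q ^ ((0 ∸ j) ℕ.* (r ∸ j)))
        ≈⟨ ∑-head r _ ⟩
      1# * G q m r * 1# + ∑ r (λ j → 0# * G q m (r ∸ suc j) * q ^ ((0 ∸ suc j) ℕ.* (r ∸ suc j)))
        ≈⟨ +-congˡ (∑-zero r λ j _ → 0*x*y≈0 _ _ refl) ⟩
      1# * G q m r * 1# + 0#
        ≈⟨ solve 1 (λ x → con (+ 1) :* x :* con (+ 1) :+ con (+ 0) := x) refl _ ⟩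
      G q m r ∎)
    vandermonde (suc n) m zero rewrite ℕₚ.*-zeroʳ n =
      solve 0 (con (+ 1) := con (+ 0) :+ con (+ 1) :* con (+ 1) :* con (+ 1)) refl
    vandermonde (suc n) m (suc r) = begin
      G q (n ℕ.+ m) r + q ^ suc r * G q (n ℕ.+ m) (suc r)
        ≈⟨ +-cong (vandermonde n m r) (*-congˡ (trans (vandermonde n m (suc r)) (∑-head (suc r) _))) ⟩
      ∑ (suc r) a + q ^ suc r * (1# * G q m (suc r) * q ^ (n ℕ.* suc r) + ∑ (suc r) b)
        ≈⟨ solve 5 (λ A Q M E B → A :+ Q :* (con (+ 1) :* M :* E :+ B)
                     := con (+ 1) :* M :* (Q :* E) :+ (A :+ Q :* B)) refl _ _ _ _ _ ⟩
      1# * G q m (suc r) * (q ^ suc r * q ^ (n ℕ.* suc r)) + (∑ (suc r) a + q ^ suc r * ∑ (suc r) b)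
        ≈⟨ +-cong (*-congˡ (sym (^-homo-* q (suc r) (n ℕ.* suc r)))) (begin
          ∑ (suc r) a + q ^ suc r * ∑ (suc r) b   ≈⟨ +-congˡ (*-distribˡ-∑ (suc r) _ b) ⟩
          ∑ (suc r) a + ∑ (suc r) (λ j → q ^ suc r * b j)   ≈⟨ ∑-distrib-+ (suc r) a _ ⟨
          ∑ (suc r) (λ j → a j + q ^ suc r * b j)
            ≈⟨ ∑-cong (suc r) (λ j j≤r → term j (ℕₚ.≤-pred j≤r)) ⟩
          ∑ (suc r) (λ j → f (suc j))   ∎) ⟩
      f 0 + ∑ (suc r) (λ j → f (suc j))
        ≈⟨ ∑-head (suc r) f ⟨
      ∑ (suc (suc r)) f ∎
      where
      f a b : ℕ → Carrier
      f j = G q (suc n) j * G q m (suc r ∸ j) * q ^ ((suc n ∸ j) ℕ.* (suc r ∸ j))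
      a j = G q n j * G q m (r ∸ j) * q ^ ((n ∸ j) ℕ.* (r ∸ j))
      b j = G q n (suc j) * G q m (r ∸ j) * q ^ ((n ∸ suc j) ℕ.* (r ∸ j))
      -- For j < n the exponents balance: (j + 1) + (n - j)(r - j) = (r + 1) + (n - j - 1)(r - j).
      -- For j ≥ n truncation spoils this, but then the binomial on both sides is zero.
      powers : ∀ j → j ℕ.≤ r →
        q ^ suc j * G q n (suc j) * q ^ ((n ∸ j) ℕ.* (r ∸ j))
          ≈ q ^ suc r * (G q n (suc j) * q ^ ((n ∸ suc j) ℕ.* (r ∸ j)))
      powers j j≤r with j ℕ.<? n
      ... | no j≮n = trans (*-congʳ (trans (*-congˡ g≈0) (zeroʳ _)))
                       (trans (zeroˡ _) (sym (trans (*-congˡ (trans (*-congʳ g≈0) (zeroˡ _))) (zeroʳ _))))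
        where
        g≈0 : G q n (suc j) ≈ 0#
        g≈0 = n<k⇒G≈0 {n} (s≤s (ℕₚ.≮⇒≥ j≮n))
      ... | yes j<n = begin
        q ^ suc j * G q n (suc j) * q ^ ((n ∸ j) ℕ.* (r ∸ j))
          ≡⟨ P.cong (λ e → q ^ suc j * G q n (suc j) * q ^ (e ℕ.* (r ∸ j)))
                (ℕₚ.suc-pred (n ∸ j) {{ℕ.>-nonZero (ℕₚ.m<n⇒0<n∸m j<n)}}) ⟨
        q ^ suc j * G q n (suc j) * q ^ ((r ∸ j) ℕ.+ ℕ.pred (n ∸ j) ℕ.* (r ∸ j))
          ≡⟨ P.cong (λ e → q ^ suc j * G q n (suc j) * q ^ ((r ∸ j) ℕ.+ e ℕ.* (r ∸ j)))
                (ℕₚ.pred[m∸n]≡m∸[1+n] n j) ⟩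
        q ^ suc j * G q n (suc j) * q ^ ((r ∸ j) ℕ.+ (n ∸ suc j) ℕ.* (r ∸ j))
          ≈⟨ *-congˡ (^-homo-* q (r ∸ j) _) ⟩
        q ^ suc j * G q n (suc j) * (q ^ (r ∸ j) * q ^ ((n ∸ suc j) ℕ.* (r ∸ j)))
          ≈⟨ solve 4 (λ p g s t → p :* g :* (s :* t) := (p :* s) :* (g :* t)) refl _ _ _ _ ⟩
        (q ^ suc j * q ^ (r ∸ j)) * (G q n (suc j) * q ^ ((n ∸ suc j) ℕ.* (r ∸ j)))
          ≈⟨ *-congʳ (sym (^-homo-* q (suc j) (r ∸ j))) ⟩
        q ^ (suc j ℕ.+ (r ∸ j)) * (G q n (suc j) * q ^ ((n ∸ suc j) ℕ.* (r ∸ j)))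
          ≡⟨ P.cong (λ e → q ^ suc e * (G q n (suc j) * q ^ ((n ∸ suc j) ℕ.* (r ∸ j)))) (ℕₚ.m+[n∸m]≡n j≤r) ⟩
        q ^ suc r * (G q n (suc j) * q ^ ((n ∸ suc j) ℕ.* (r ∸ j))) ∎
      term : ∀ j → j ℕ.≤ r → a j + q ^ suc r * b j ≈ f (suc j)
      term j j≤r = begin
        x * M * E + q ^ suc r * (y * M * E′)
          ≈⟨ +-congˡ (solve 4 (λ Q y M E′ → Q :* (y :* M :* E′) := M :* (Q :* (y :* E′))) refl _ _ _ _) ⟩
        x * M * E + M * (q ^ suc r * (y * E′))
          ≈⟨ +-congˡ (*-congˡ (powers j j≤r)) ⟨
        x * M * E + M * (q ^ suc j * y * E)
          ≈⟨ solve 5 (λ x M E p y → x :* M :* E :+ M :* (p :* y :* E) := (x :+ p :* y) :* M :* E) refl _ _ _ _ _ ⟩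
        (x + q ^ suc j * y) * M * E ∎
        where
        x y M E E′ : Carrier
        x = G q n j
        y = G q n (suc j)
        M = G q m (r ∸ j)
        E = q ^ ((n ∸ j) ℕ.* (r ∸ j))
        E′ = q ^ ((n ∸ suc j) ℕ.* (r ∸ j))

  G-cong : ∀ {q r} → q ≈ r → ∀ n k → G q n k ≈ G r n k
  G-cong q≈r n zero = refl
  G-cong q≈r zero (suc k) = refl
  G-cong q≈r (suc n) (suc k) = +-cong (G-cong q≈r n k) (*-cong (^-congˡ (suc k) q≈r) (G-cong q≈r n (suc k)))

  module _ (q : Carrier) where

    ∑-powers-+ : ∀ m n → ∑ (m ℕ.+ n) (q ^_) ≈ ∑ m (q ^_) + q ^ m * ∑ n (q ^_)
    ∑-powers-+ m n = trans (∑-split m n (q ^_))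
      (+-congˡ (trans (∑-cong n λ i _ → ^-homo-* q m i) (sym (*-distribˡ-∑ n _ _))))

    -- Pascal's rule fits the splitting [i + j] = [i] + q^i [j] of `∑-powers-+`. The factorial is an
    -- abstract `F` so that `qfact` can take its place, whose factors are lists of ones and not sums
    -- of powers.
    G-factorial : (F : ℕ → Carrier) → F 0 ≈ 1# → (∀ n → F (suc n) ≈ ∑ (suc n) (q ^_) * F n) →
      ∀ i j → G q (i ℕ.+ j) i * (F i * F j) ≈ F (i ℕ.+ j)
    G-factorial F F0 Fsuc zero j = trans (*-identityˡ _) (trans (*-congʳ F0) (*-identityˡ _))
    G-factorial F F0 Fsuc (suc i) zero rewrite ℕₚ.+-identityʳ i =
      trans (*-cong (G-self q (suc i)) (trans (*-congˡ F0) (*-identityʳ _))) (*-identityˡ _)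
    G-factorial F F0 Fsuc (suc i) (suc j) = begin
      (g + p * h) * (F (suc i) * F (suc j))
        ≈⟨ solve 5 (λ g p h a b → (g :+ p :* h) :* (a :* b) := g :* (a :* b) :+ p :* (h :* (a :* b))) refl g p h _ _ ⟩
      g * (F (suc i) * F (suc j)) + p * (h * (F (suc i) * F (suc j)))
        ≈⟨ +-cong (*-congˡ (*-congʳ (Fsuc i))) (*-congˡ (*-congˡ (*-congˡ (Fsuc j)))) ⟩
      g * (S * F i * F (suc j)) + p * (h * (F (suc i) * (T * F j)))
        ≈⟨ solve 9 (λ g p h S T a b c d → g :* (S :* a :* b) :+ p :* (h :* (c :* (T :* d)))
             := S :* (g :* (a :* b)) :+ p :* T :* (h :* (c :* d))) refl g p h S T (F i) (F (suc j)) (F (suc i)) (F j) ⟩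
      S * (g * (F i * F (suc j))) + p * T * (h * (F (suc i) * F j))
        ≈⟨ +-cong (*-congˡ (G-factorial F F0 Fsuc i (suc j))) (*-congˡ ih) ⟩
      S * F (i ℕ.+ suc j) + p * T * F (i ℕ.+ suc j)
        ≈⟨ distribʳ _ _ _ ⟨
      (S + p * T) * F (i ℕ.+ suc j)
        ≈⟨ *-congʳ (∑-powers-+ (suc i) (suc j)) ⟨
      ∑ (suc i ℕ.+ suc j) (q ^_) * F (i ℕ.+ suc j)
        ≈⟨ Fsuc (i ℕ.+ suc j) ⟨
      F (suc (i ℕ.+ suc j)) ∎
      where
      g p h S T : Carrier
      g = G q (i ℕ.+ suc j) i
      h = G q (i ℕ.+ suc j) (suc i)
      p = q ^ suc i
      S = ∑ (suc i) (q ^_)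
      T = ∑ (suc j) (q ^_)
      ih : h * (F (suc i) * F j) ≈ F (i ℕ.+ suc j)
      ih = P.subst (λ m → G q m (suc i) * (F (suc i) * F j) ≈ F m) (P.sym (ℕₚ.+-suc i j))
                   (G-factorial F F0 Fsuc (suc i) j)

  module _ (x : Carrier) where

    geometric : ∀ m → (1# - x) * ∑ m (x ^_) ≈ 1# - x ^ m
    geometric zero = solve 1 (λ x → (con (+ 1) :- x) :* con (+ 0) := con (+ 1) :- con (+ 1)) refl x
    geometric (suc m) = begin
      (1# - x) * (∑ m (x ^_) + x ^ m)            ≈⟨ distribˡ _ _ _ ⟩
      (1# - x) * ∑ m (x ^_) + (1# - x) * x ^ m   ≈⟨ +-congʳ (geometric m) ⟩
      (1# - x ^ m) + (1# - x) * x ^ m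
        ≈⟨ solve 2 (λ x p → (con (+ 1) :- p) :+ (con (+ 1) :- x) :* p := con (+ 1) :- x :* p) refl x (x ^ m) ⟩
      1# - x ^ suc m                             ∎

    geometric-reversed : ∀ m → (1# - x) * ∑ m (λ j → x ^ (m ∸ j)) ≈ x - x ^ suc m
    geometric-reversed zero =
      solve 1 (λ x → (con (+ 1) :- x) :* con (+ 0) := x :- x :* con (+ 1)) refl x
    geometric-reversed (suc m) = begin
      (1# - x) * ∑ (suc m) (λ j → x ^ (suc m ∸ j))                        ≈⟨ *-congˡ (∑-head m _) ⟩
      (1# - x) * (x ^ suc m + ∑ m (λ j → x ^ (m ∸ j)))                    ≈⟨ distribˡ _ _ _ ⟩
      (1# - x) * x ^ suc m + (1# - x) * ∑ m (λ j → x ^ (m ∸ j))           ≈⟨ +-congˡ (geometric-reversed m) ⟩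
      (1# - x) * x ^ suc m + (x - x ^ suc m)
        ≈⟨ solve 2 (λ x p → (con (+ 1) :- x) :* p :+ (x :- p) := x :- x :* p) refl x (x ^ suc m) ⟩
      x - x ^ suc (suc m)                                                 ∎

    -- Summation by parts. The geometric sum is not evaluated, because it is the quantity that
    -- vanishes for a root of unity x ≠ 1.
    arithmetico-geometric : ∀ m →
      (1# - x) * ∑ m (λ i → ι i * x ^ i) ≈ ∑ m (x ^_) - 1# + x ^ m - ι m * x ^ m
    arithmetico-geometric zero =
      solve 1 (λ x → (con (+ 1) :- x) :* con (+ 0) := con (+ 0) :- con (+ 1) :+ con (+ 1) :- con (+ 0) :* con (+ 1)) refl x
    arithmetico-geometric (suc m) = begin
      (1# - x) * (A + ι m * p)                   ≈⟨ distribˡ _ _ _ ⟩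
      (1# - x) * A + (1# - x) * (ι m * p)        ≈⟨ +-congʳ (arithmetico-geometric m) ⟩
      (S - 1# + p - ι m * p) + (1# - x) * (ι m * p)
        ≈⟨ solve 4 (λ x s p t → (s :- con (+ 1) :+ p :- t :* p) :+ (con (+ 1) :- x) :* (t :* p)
            := (s :+ p) :- con (+ 1) :+ x :* p :- (con (+ 1) :+ t) :* (x :* p)) refl x S p (ι m) ⟩
      (S + p) - 1# + x * p - (1# + ι m) * (x * p)
        ≈⟨ +-congˡ (-‿cong (*-congʳ (sym (ι-suc m)))) ⟩
      (S + p) - 1# + x * p - ι (suc m) * (x * p) ∎
      where
      A S p : Carrier
      A = ∑ m (λ i → ι i * x ^ i)
      S = ∑ m (x ^_)
      p = x ^ m

    -- Summation by parts again, with i (N - i) - (i - 1)(N - i + 1) = N + 1 - 2i. The length `m` is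
    -- separate from `N` to allow induction on `m`; the use is at m = N = n.
    quadratic-geometric : ∀ N m →
      (1# - x) * ∑ m (λ i → (ι i * (N - ι i)) * x ^ i)
        ≈ (N + 1#) * ∑ m (x ^_) - ι 2 * ∑ m (λ i → ι i * x ^ i)
          - (N + 1#) - (ι m - 1#) * (N - ι m + 1#) * x ^ m
    quadratic-geometric N zero =
      solve 2 (λ x N → (con (+ 1) :- x) :* con (+ 0) := (N :+ con (+ 1)) :* con (+ 0) :- con (+ 2) :* con (+ 0)
          :- (N :+ con (+ 1)) :- (con (+ 0) :- con (+ 1)) :* (N :- con (+ 0) :+ con (+ 1)) :* con (+ 1)) refl x N
    quadratic-geometric N (suc m) = begin
      (1# - x) * (Y + t * (N - t) * p)                   ≈⟨ distribˡ _ _ _ ⟩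
      (1# - x) * Y + (1# - x) * (t * (N - t) * p)        ≈⟨ +-congʳ (quadratic-geometric N m) ⟩
      ((N + 1#) * S - ι 2 * A - (N + 1#) - (t - 1#) * (N - t + 1#) * p) + (1# - x) * (t * (N - t) * p)
        ≈⟨ solve 6 (λ x N S A t p →
             ((N :+ con (+ 1)) :* S :- con (+ 2) :* A :- (N :+ con (+ 1)) :- (t :- con (+ 1)) :* (N :- t :+ con (+ 1)) :* p)
               :+ (con (+ 1) :- x) :* (t :* (N :- t) :* p)
             := (N :+ con (+ 1)) :* (S :+ p) :- con (+ 2) :* (A :+ t :* p) :- (N :+ con (+ 1))
                 :- ((con (+ 1) :+ t) :- con (+ 1)) :* (N :- (con (+ 1) :+ t) :+ con (+ 1)) :* (x :* p)) refl x N S A t p ⟩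
      (N + 1#) * (S + p) - ι 2 * (A + t * p) - (N + 1#) - ((1# + t) - 1#) * (N - (1# + t) + 1#) * (x * p)
        ≈⟨ +-congˡ (-‿cong (*-congʳ (*-cong (+-congʳ (sym (ι-suc m))) (+-congʳ (+-congˡ (-‿cong (sym (ι-suc m)))))))) ⟩
      (N + 1#) * (S + p) - ι 2 * (A + t * p) - (N + 1#) - (ι (suc m) - 1#) * (N - ι (suc m) + 1#) * (x * p) ∎
      where
      Y A S p t : Carrier
      Y = ∑ m (λ i → (ι i * (N - ι i)) * x ^ i)
      A = ∑ m (λ i → ι i * x ^ i)
      S = ∑ m (x ^_)
      p = x ^ m
      t = ι m

  -- At `N = ι m` the right side becomes N (N² - 1), which is the origin of n² - 1 in the theorem.
  ∑-quadratic : ∀ N m → ι 6 * ∑ m (λ i → ι i * (N - ι i))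
                ≈ (ι m - 1#) * ι m * (ι 3 * N - (ι 2 * ι m - 1#))
  ∑-quadratic N zero = solve 1 (λ N → con (+ 6) :* con (+ 0) :=
    (con (+ 0) :- con (+ 1)) :* con (+ 0) :* (con (+ 3) :* N :- (con (+ 2) :* con (+ 0) :- con (+ 1)))) refl N
  ∑-quadratic N (suc m) = begin
    ι 6 * (∑ m (λ i → ι i * (N - ι i)) + t * (N - t))   ≈⟨ distribˡ _ _ _ ⟩
    ι 6 * ∑ m (λ i → ι i * (N - ι i)) + ι 6 * (t * (N - t))   ≈⟨ +-congʳ (∑-quadratic N m) ⟩
    (t - 1#) * t * (ι 3 * N - (ι 2 * t - 1#)) + ι 6 * (t * (N - t))
      ≈⟨ solve 2 (λ N t → (t :- con (+ 1)) :* t :* (con (+ 3) :* N :- (con (+ 2) :* t :- con (+ 1)))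
             :+ con (+ 6) :* (t :* (N :- t))
         := ((con (+ 1) :+ t) :- con (+ 1)) :* (con (+ 1) :+ t)
             :* (con (+ 3) :* N :- (con (+ 2) :* (con (+ 1) :+ t) :- con (+ 1)))) refl N t ⟩
    ((1# + t) - 1#) * (1# + t) * (ι 3 * N - (ι 2 * (1# + t) - 1#))
      ≈⟨ *-cong (*-cong (+-congʳ s) s) (+-congˡ (-‿cong (+-congʳ (*-congˡ s)))) ⟩
    (ι (suc m) - 1#) * ι (suc m) * (ι 3 * N - (ι 2 * ι (suc m) - 1#)) ∎
    where
    t : Carrier
    t = ι m
    s : 1# + t ≈ ι (suc m)
    s = sym (ι-suc m)

-- Congruences modulo powers of an element

module Congruence (R : CommutativeRing 0ℓ 0ℓ) (Φ : CommutativeRing.Carrier R) where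

  open CommutativeRing R hiding (zero)
  open import Algebra.Properties.Ring ring
  open import Algebra.Properties.CommutativeSemiring.Exp commutativeSemiring
  open IntegerSolver R
  open GaussianBinomials R

  -- The ideal generated by `Φ ^ k`. Ideals with an explicit exponent are preferred to a quotient
  -- ring because congruences modulo Φ, Φ² and Φ³ are combined with each other.
  record I (k : ℕ) (x : Carrier) : Set where
    constructor mkI
    field
      quotient : Carrier
      equality : x ≈ quotient * Φ ^ k

  infix 4 _≈[_]_
  _≈[_]_ : Carrier → ℕ → Carrier → Set
  x ≈[ k ] y = I k (x - y)

  I-resp : ∀ {k x y} → x ≈ y → I k x → I k y
  I-resp x≈y (mkI h x≈h) = mkI h (trans (sym x≈y) x≈h)

  I-0 : ∀ {k x} → x ≈ 0# → I k x
  I-0 x≈0 = mkI 0# (trans x≈0 (sym (zeroˡ _)))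

  I-+ : ∀ {k x y} → I k x → I k y → I k (x + y)
  I-+ (mkI h x≈) (mkI g y≈) = mkI (h + g) (trans (+-cong x≈ y≈) (sym (distribʳ _ h g)))

  I-scale : ∀ {k x} c → I k x → I k (c * x)
  I-scale c (mkI h x≈) = mkI (c * h) (trans (*-congˡ x≈) (sym (*-assoc c h _)))

  I-neg : ∀ {k x} → I k x → I k (- x)
  I-neg {x = x} Ix = I-resp (-1*x≈-x x) (I-scale (- 1#) Ix)

  I-* : ∀ {i j x y} → I i x → I j y → I (i ℕ.+ j) (x * y)
  I-* {i} {j} (mkI h x≈) (mkI g y≈) = mkI (h * g) (trans (*-cong x≈ y≈)
    (trans (solve 4 (λ h p g r → (h :* p) :* (g :* r) := (h :* g) :* (p :* r)) refl _ _ _ _)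
           (*-congˡ (sym (^-homo-* Φ i j)))))

  I-∑ : ∀ {k} n {f : ℕ → Carrier} → (∀ i → i ℕ.< n → I k (f i)) → I k (∑ n f)
  I-∑ zero If = I-0 refl
  I-∑ (suc n) If = I-+ (I-∑ n λ i i<n → If i (ℕₚ.m<n⇒m<1+n i<n)) (If n ℕₚ.≤-refl)

  ≈⇒mod : ∀ {k x y} → x ≈ y → x ≈[ k ] y
  ≈⇒mod x≈y = I-0 (x≈y⇒x-y≈0 x≈y)

  mod-refl : ∀ {k x} → x ≈[ k ] x
  mod-refl = ≈⇒mod refl

  mod-sym : ∀ {k x y} → x ≈[ k ] y → y ≈[ k ] x
  mod-sym {x = x} {y} p = I-resp (solve 2 (λ x y → :- (x :- y) := y :- x) refl x y) (I-neg p)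

  mod-trans : ∀ {k x y z} → x ≈[ k ] y → y ≈[ k ] z → x ≈[ k ] z
  mod-trans {x = x} {y} {z} p r =
    I-resp (solve 3 (λ x y z → (x :- y) :+ (y :- z) := x :- z) refl x y z) (I-+ p r)

  mod-+ : ∀ {k x x′ y y′} → x ≈[ k ] x′ → y ≈[ k ] y′ → x + y ≈[ k ] x′ + y′
  mod-+ {x = x} {x′} {y} {y′} p r =
    I-resp (solve 4 (λ x x′ y y′ → (x :- x′) :+ (y :- y′) := (x :+ y) :- (x′ :+ y′)) refl x x′ y y′) (I-+ p r)

  mod-neg : ∀ {k x x′} → x ≈[ k ] x′ → - x ≈[ k ] - x′
  mod-neg {x = x} {x′} p = I-resp (solve 2 (λ x x′ → :- (x :- x′) := (:- x) :- (:- x′)) refl x x′) (I-neg p)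

  -- The source of precision: beside a factor that is already divisible by Φ, a coarser congruence
  -- suffices.
  mod-lift : ∀ {i j x y z} → I i x → y ≈[ j ] z → x * y ≈[ i ℕ.+ j ] x * z
  mod-lift {x = x} {y} {z} Ix p = I-resp (x[y-z]≈xy-xz x y z) (I-* Ix p)

  mod-*ˡ : ∀ {k y z} x → y ≈[ k ] z → x * y ≈[ k ] x * z
  mod-*ˡ {y = y} {z} x p = I-resp (x[y-z]≈xy-xz x y z) (I-scale x p)

  mod-*ʳ : ∀ {k y z} x → y ≈[ k ] z → y * x ≈[ k ] z * x
  mod-*ʳ x p = mod-trans (≈⇒mod (*-comm _ _)) (mod-trans (mod-*ˡ x p) (≈⇒mod (*-comm _ _)))

  mod-* : ∀ {k x x′ y y′} → x ≈[ k ] x′ → y ≈[ k ] y′ → x * y ≈[ k ] x′ * y′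
  mod-* {x′ = x′} {y} p r = mod-trans (mod-*ʳ y p) (mod-*ˡ x′ r)

  mod-1^ : ∀ {k x} n → x ≈[ k ] 1# → x ^ n ≈[ k ] 1#
  mod-1^ zero p = mod-refl
  mod-1^ (suc n) p = mod-trans (mod-* p (mod-1^ n p)) (≈⇒mod (*-identityˡ 1#))

  I-mod : ∀ {k x y} → x ≈[ k ] y → I k y → I k x
  I-mod {x = x} {y} p Iy = I-resp (solve 2 (λ x y → (x :- y) :+ y := x) refl x y) (I-+ p Iy)

  mod-∑ : ∀ {k} n {f g : ℕ → Carrier} → (∀ i → i ℕ.< n → f i ≈[ k ] g i) → ∑ n f ≈[ k ] ∑ n g
  mod-∑ zero p = mod-refl
  mod-∑ (suc n) p = mod-+ (mod-∑ n λ i i<n → p i (ℕₚ.m<n⇒m<1+n i<n)) (p n ℕₚ.≤-refl)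

  +I : ∀ {k x y} → I k y → x + y ≈[ k ] x
  +I {x = x} {y} Iy = I-resp (solve 2 (λ x y → y := (x :+ y) :- x) refl x y) Iy

  I+ : ∀ {k x y} → I k x → x + y ≈[ k ] y
  I+ {x = x} {y} Ix = I-resp (solve 2 (λ x y → x := (x :+ y) :- y) refl x y) Ix

  ∑-single : ∀ {k} n {f : ℕ → Carrier} i → i ℕ.< n →
    (∀ j → j ℕ.< n → j ≢ i → I k (f j)) → ∑ n f ≈[ k ] f i
  ∑-single (suc n) i i<1+n Ij with i ℕₚ.≟ n
  ... | yes P.refl = I+ (I-∑ n λ j j<n → Ij j (ℕₚ.m<n⇒m<1+n j<n) (ℕₚ.<⇒≢ j<n))
  ... | no i≢n = mod-trans (+I (Ij n ℕₚ.≤-refl (λ n≡i → i≢n (P.sym n≡i))))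
      (∑-single n i (ℕₚ.≤∧≢⇒< (ℕₚ.≤-pred i<1+n) i≢n) λ j j<n → Ij j (ℕₚ.m<n⇒m<1+n j<n))

  infixr 2 _∼⟨_⟩_ _≃⟨_⟩_
  infix 3 _∎ₘ

  _∼⟨_⟩_ : ∀ {k} x {y z} → x ≈[ k ] y → y ≈[ k ] z → x ≈[ k ] z
  _ ∼⟨ p ⟩ r = mod-trans p r

  _≃⟨_⟩_ : ∀ {k} x {y z} → x ≈ y → y ≈[ k ] z → x ≈[ k ] z
  _ ≃⟨ p ⟩ r = mod-trans (≈⇒mod p) r

  _∎ₘ : ∀ {k} x → x ≈[ k ] x
  _ ∎ₘ = mod-refl

-- The congruence modulo Φ³ in an abstract ring

module Ljunggren (R : CommutativeRing 0ℓ 0ℓ) (Φ q : CommutativeRing.Carrier R) (n′ : ℕ) where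

  open CommutativeRing R hiding (zero)
  open import Algebra.Properties.CommutativeSemiring.Exp commutativeSemiring
  open IntegerSolver R
  open GaussianBinomials R
  open Congruence R Φ
  open CommutativeSemigroupProperties ℕₚ.+-commutativeSemigroup using (x∙yz≈y∙xz)
  open import Relation.Binary.Reasoning.Setoid setoid

  n : ℕ
  n = suc n′

  ε : Carrier
  ε = 1# - q ^ n

  -- The two binomials have lower indices adding up to n, as Vandermonde's identity delivers them;
  -- `W-mod` identifies them by symmetry. The summation variable of the overview is `n′ ∸ j`.
  W : Carrier
  W = ∑ n′ (λ j → G q n (suc j) * G q n (n′ ∸ j) * q ^ ((n′ ∸ j) ℕ.* (n′ ∸ j)))

  module _ (Φ∣ε : I 1 ε)
           (inverse : ∀ k → 0 ℕ.< k → k ℕ.< n → ∃ λ v → v * (1# - q ^ k) ≈[ 1 ] 1#)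
    where

    q^n≈1 : q ^ n ≈[ 1 ] 1#
    q^n≈1 = mod-sym Φ∣ε

    q^[n*k]≈1 : ∀ k → q ^ (n ℕ.* k) ≈[ 1 ] 1#
    q^[n*k]≈1 k = mod-trans (≈⇒mod (sym (^-assocʳ q n k))) (mod-1^ k q^n≈1)

    q^[k*n]≈1 : ∀ k → q ^ (k ℕ.* n) ≈[ 1 ] 1#
    q^[k*n]≈1 k rewrite ℕₚ.*-comm k n = q^[n*k]≈1 k

    [q^k]^n≈1 : ∀ k → (q ^ k) ^ n ≈[ 1 ] 1#
    [q^k]^n≈1 k = mod-trans (≈⇒mod (^-assocʳ q k n)) (q^[k*n]≈1 k)

    I-cancel : ∀ k {x} → 0 ℕ.< k → k ℕ.< n → I 1 ((1# - q ^ k) * x) → I 1 x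
    I-cancel k {x} 0<k k<n Iux = let (v , vu≈1) = inverse k 0<k k<n in
      I-resp (solve 3 (λ v u x → v :* (u :* x) :- (v :* u :- con (+ 1)) :* x := x) refl v _ x)
        (I-+ (I-scale v Iux) (I-neg (I-resp (*-comm x _) (I-scale x vu≈1))))

    Φ∣G : ∀ k → 0 ℕ.< k → k ℕ.< n → I 1 (G q n k)
    Φ∣G (suc k) 0<k k<n = I-cancel (suc k) 0<k k<n
      (I-resp (trans (*-comm _ _) (sym (G-absorb q n′ k))) (I-scale (G q n′ k) Φ∣ε))

    -- Modulo Φ, G q n′ k is ± q ^ (- (k * (k + 1) / 2)); squaring removes both the sign and the half.
    G²-mod : ∀ k → k ℕ.< n → (G q n′ k * G q n′ k) * q ^ (suc k ℕ.* k) ≈[ 1 ] 1#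
    G²-mod zero _ = ≈⇒mod (solve 0 (con (+ 1) :* con (+ 1) :* con (+ 1) := con (+ 1)) refl)
    G²-mod (suc k) 1+k<n =
      (b * b) * q ^ (suc (suc k) ℕ.* suc k)
        ≃⟨ (*-congˡ exponents) ⟩
      (b * b) * (Q * Q * q ^ (suc k ℕ.* k))
        ≃⟨ (solve 3 (λ b Q p → b :* b :* (Q :* Q :* p) := (Q :* b) :* (Q :* b) :* p) refl b Q _) ⟩
      (Q * b) * (Q * b) * q ^ (suc k ℕ.* k)
        ∼⟨ mod-*ʳ _ (mod-* Qb≈-a Qb≈-a) ⟩
      (- a) * (- a) * q ^ (suc k ℕ.* k)
        ≃⟨ (solve 2 (λ a p → (:- a) :* (:- a) :* p := a :* a :* p) refl a _) ⟩
      (a * a) * q ^ (suc k ℕ.* k)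
        ∼⟨ G²-mod k (ℕₚ.<-trans ℕₚ.≤-refl 1+k<n) ⟩
      1# ∎ₘ
      where
      a b Q : Carrier
      a = G q n′ k
      b = G q n′ (suc k)
      Q = q ^ suc k
      -- By Pascal's rule `a + Q * b` is `G q n (suc k)`, a multiple of Φ.
      Qb≈-a : Q * b ≈[ 1 ] - a
      Qb≈-a = I-resp (solve 2 (λ a x → a :+ x := x :- (:- a)) refl a (Q * b)) (Φ∣G (suc k) (s≤s z≤n) 1+k<n)
      exponents : q ^ (suc (suc k) ℕ.* suc k) ≈ Q * Q * q ^ (suc k ℕ.* k)
      exponents = begin
        q ^ (suc k ℕ.+ suc k ℕ.* suc k)
          ≈⟨ ^-homo-* q (suc k) _ ⟩
        Q * q ^ (suc k ℕ.* suc k)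
          ≈⟨ *-congˡ (trans (^-congʳ q (ℕₚ.*-suc (suc k) k)) (^-homo-* q (suc k) _)) ⟩
        Q * (Q * q ^ (suc k ℕ.* k))
          ≈⟨ *-assoc _ _ _ ⟨
        Q * Q * q ^ (suc k ℕ.* k) ∎

    -- 2 n x / (1 - x)² for an n-th root of unity x = q ^ k ≠ 1.
    y : ℕ → Carrier
    y k = ∑ n (λ i → (ι i * (ι n - ι i)) * (q ^ k) ^ i)

    -- For x = q^k both x^n - 1 and the sum of all x^i vanish modulo Φ, so that two summations by
    -- parts collapse to a single monomial.
    y-mod : ∀ k → 0 ℕ.< k → k ℕ.< n →
      (1# - q ^ k) * (1# - q ^ k) * y k ≈[ 1 ] ι 2 * ι n * q ^ k
    y-mod k 0<k k<n =
      (1# - x) * (1# - x) * y k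
        ≃⟨ (trans (*-assoc _ _ _) (*-congˡ (quadratic-geometric x (ι n) n))) ⟩
      (1# - x) * ((ι n + 1#) * S - ι 2 * A - (ι n + 1#) - (ι n - 1#) * (ι n - ι n + 1#) * x ^ n)
        ∼⟨ mod-*ˡ _ (mod-+ (mod-+ (mod-+ (mod-*ˡ _ S≈0) mod-refl) mod-refl) (mod-neg (mod-*ˡ _ ([q^k]^n≈1 k)))) ⟩
      (1# - x) * ((ι n + 1#) * 0# - ι 2 * A - (ι n + 1#) - (ι n - 1#) * (ι n - ι n + 1#) * 1#)
        ≃⟨ (solve 3 (λ x N A → (con (+ 1) :- x) :* ((N :+ con (+ 1)) :* con (+ 0) :- con (+ 2) :* A :- (N :+ con (+ 1))
              :- (N :- con (+ 1)) :* (N :- N :+ con (+ 1)) :* con (+ 1))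
             := (:- con (+ 2)) :* ((con (+ 1) :- x) :* A) :- con (+ 2) :* N :* (con (+ 1) :- x)) refl x (ι n) A) ⟩
      - ι 2 * ((1# - x) * A) - ι 2 * ι n * (1# - x)
        ∼⟨ mod-+ (≈⇒mod (*-congˡ (arithmetico-geometric x n))) mod-refl ⟩
      - ι 2 * (S - 1# + x ^ n - ι n * x ^ n) - ι 2 * ι n * (1# - x)
        ∼⟨ mod-+ (mod-*ˡ _ (mod-+ (mod-+ (mod-+ S≈0 mod-refl) ([q^k]^n≈1 k))
                                 (mod-neg (mod-*ˡ _ ([q^k]^n≈1 k))))) mod-refl ⟩
      - ι 2 * (0# - 1# + 1# - ι n * 1#) - ι 2 * ι n * (1# - x)
        ≃⟨ (solve 2 (λ x N → (:- con (+ 2)) :* (con (+ 0) :- con (+ 1) :+ con (+ 1) :- N :* con (+ 1))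
                    :- con (+ 2) :* N :* (con (+ 1) :- x) := con (+ 2) :* N :* x) refl x (ι n)) ⟩
      ι 2 * ι n * x ∎ₘ
      where
      x S A : Carrier
      x = q ^ k
      S = ∑ n (x ^_)
      A = ∑ n (λ i → ι i * x ^ i)
      S≈0 : S ≈[ 1 ] 0#
      S≈0 = I-resp (solve 1 (λ s → s := s :- con (+ 0)) refl S) (I-cancel k 0<k k<n
        (I-resp (sym (geometric x n)) (mod-sym ([q^k]^n≈1 k))))

    -- The n powers of q^i add up to 0 modulo Φ, and the one left out is 1. The exponents descend
    -- because `W` is indexed by `n′ ∸ j`.
    ∑-powers : ∀ i → 0 ℕ.< i → i ℕ.< n → ∑ n′ (λ j → (q ^ (n′ ∸ j)) ^ i) ≈[ 1 ] - 1#
    ∑-powers i 0<i i<n = I-resp (+-cong (∑-cong n′ λ j _ → comm j) refl) (I-cancel i 0<i i<n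
        (I-resp (sym (begin
          (1# - x) * (∑ n′ (λ j → x ^ (n′ ∸ j)) - - 1#)
            ≈⟨ solve 2 (λ x r → (con (+ 1) :- x) :* (r :- (:- con (+ 1))) := (con (+ 1) :- x) :* r :+ (con (+ 1) :- x)) refl x _ ⟩
          (1# - x) * ∑ n′ (λ j → x ^ (n′ ∸ j)) + (1# - x)
            ≈⟨ +-congʳ (geometric-reversed x n′) ⟩
          (x - x ^ n) + (1# - x)
            ≈⟨ solve 2 (λ x p → (x :- p) :+ (con (+ 1) :- x) := con (+ 1) :- p) refl x (x ^ n) ⟩
          1# - x ^ n ∎)) (mod-sym ([q^k]^n≈1 i))))
      where
      x : Carrier
      x = q ^ i
      comm : ∀ j → (q ^ i) ^ (n′ ∸ j) ≈ (q ^ (n′ ∸ j)) ^ i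
      comm j = trans (^-assocʳ q i (n′ ∸ j)) (trans (^-congʳ q (ℕₚ.*-comm i (n′ ∸ j))) (sym (^-assocʳ q (n′ ∸ j) i)))

    -- After the sums are exchanged, the inner one is -1 for every i > 0, and the weight i (n - i)
    -- removes i = 0.
    ∑y-mod : ι 6 * ∑ n′ (λ j → y (n′ ∸ j)) ≈[ 1 ] - (ι n * (ι n * ι n - 1#))
    ∑y-mod =
      ι 6 * ∑ n′ (λ j → y (n′ ∸ j))
        ≃⟨ (*-congˡ (trans (∑-swap n′ n _) (∑-cong n λ i _ → sym (*-distribˡ-∑ n′ _ _)))) ⟩
      ι 6 * ∑ n (λ i → c i * ∑ n′ (λ j → (q ^ (n′ ∸ j)) ^ i))
        ∼⟨ mod-*ˡ _ (mod-∑ n term) ⟩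
      ι 6 * ∑ n (λ i → - 1# * c i)
        ≃⟨ (trans (*-congˡ (sym (*-distribˡ-∑ n (- 1#) c)))
             (solve 2 (λ a s → a :* ((:- con (+ 1)) :* s) := :- (a :* s)) refl (ι 6) (∑ n c))) ⟩
      - (ι 6 * ∑ n c)
        ≃⟨ (-‿cong (trans (∑-quadratic (ι n) n) (solve 1 (λ N →
              (N :- con (+ 1)) :* N :* (con (+ 3) :* N :- (con (+ 2) :* N :- con (+ 1)))
                := N :* (N :* N :- con (+ 1))) refl (ι n)))) ⟩
      - (ι n * (ι n * ι n - 1#)) ∎ₘ
      where
      c : ℕ → Carrier
      c i = ι i * (ι n - ι i)
      term : ∀ i → i ℕ.< n → c i * ∑ n′ (λ j → (q ^ (n′ ∸ j)) ^ i) ≈[ 1 ] - 1# * c i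
      term zero _ = ≈⇒mod (solve 2 (λ N s → con (+ 0) :* (N :- con (+ 0)) :* s
                                       := (:- con (+ 1)) :* (con (+ 0) :* (N :- con (+ 0)))) refl (ι n) _)
      term (suc i) i<n = mod-trans (mod-*ˡ _ (∑-powers (suc i) (s≤s z≤n) i<n)) (≈⇒mod (*-comm _ _))

    -- The multiplier 2n clears the denominator hidden in `y`, since neither 2 nor n is invertible
    -- here.
    G²-term : ∀ k → 0 ℕ.< k → k ℕ.< n →
      ι 2 * ι n * (G q n k * G q n k * q ^ (k ℕ.* k)) ≈[ 3 ] (ε * ε) * y k
    G²-term (suc k) 0<k k<n =
      ι 2 * ι n * (b * b * p)
        ∼⟨ mod-*ˡ _ (mod-*ʳ p squares) ⟩
      ι 2 * ι n * (z * z * p)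
        ≃⟨ (solve 5 (λ N v e a p → con (+ 2) :* N :* ((v :* e :* a) :* (v :* e :* a) :* p)
                    := (e :* e) :* (con (+ 2) :* N :* (v :* v) :* (a :* a :* p))) refl (ι n) v ε a p) ⟩
      (ε * ε) * (ι 2 * ι n * (v * v) * (a * a * p))
        ∼⟨ mod-lift (I-* Φ∣ε Φ∣ε) core ⟩
      (ε * ε) * y (suc k) ∎ₘ
      where
      a b p v u z : Carrier
      a = G q n′ k
      b = G q n (suc k)
      p = q ^ (suc k ℕ.* suc k)
      u = 1# - q ^ suc k
      v = proj₁ (inverse (suc k) 0<k k<n)
      z = v * ε * a
      vu≈1 : v * u ≈[ 1 ] 1#
      vu≈1 = proj₂ (inverse (suc k) 0<k k<n)
      -- `v` inverts `u` modulo Φ only, but the resulting error b (vu - 1) has a second factor Φ in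
      -- `b`.
      b≈z : b ≈[ 2 ] z
      b≈z = I-resp (begin
          - (b * (v * u - 1#))
            ≈⟨ solve 3 (λ b v u → :- (b :* (v :* u :- con (+ 1))) := b :- v :* (u :* b)) refl b v u ⟩
          b - v * (u * b)
            ≈⟨ +-congˡ (-‿cong (trans (*-congˡ (G-absorb q n′ k)) (sym (*-assoc _ _ _)))) ⟩
          b - z ∎)
        (I-neg (I-* (Φ∣G (suc k) 0<k k<n) vu≈1))
      -- A difference of squares: `b - z` supplies Φ² and `b + z` one more Φ.
      squares : b * b ≈[ 3 ] z * z
      squares = I-resp (solve 2 (λ b z → (b :- z) :* (b :+ z) := b :* b :- z :* z) refl b z)
        (I-* b≈z (I-+ (Φ∣G (suc k) 0<k k<n)
          (I-resp (solve 3 (λ v a e → (v :* a) :* e := v :* e :* a) refl v a ε) (I-scale (v * a) Φ∣ε))))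
      core : ι 2 * ι n * (v * v) * (a * a * p) ≈[ 1 ] y (suc k)
      core =
        ι 2 * ι n * (v * v) * (a * a * p)
          ≃⟨ (trans (*-congˡ (*-congˡ (trans (^-congʳ q (ℕₚ.*-suc (suc k) k)) (^-homo-* q (suc k) _))))
               (solve 5 (λ N v a Q r → con (+ 2) :* N :* (v :* v) :* (a :* a :* (Q :* r))
                  := (con (+ 2) :* N :* Q) :* (v :* v) :* (a :* a :* r)) refl (ι n) v a _ _)) ⟩
        ι 2 * ι n * q ^ suc k * (v * v) * (a * a * q ^ (suc k ℕ.* k))
          ∼⟨ mod-* (mod-*ʳ _ (mod-sym (y-mod (suc k) 0<k k<n))) (G²-mod k (ℕₚ.<-trans ℕₚ.≤-refl k<n)) ⟩
        u * u * y (suc k) * (v * v) * 1#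
          ≃⟨ (solve 3 (λ u v y → u :* u :* y :* (v :* v) :* con (+ 1) := (v :* u) :* (v :* u) :* y) refl u v _) ⟩
        (v * u) * (v * u) * y (suc k)
          ∼⟨ mod-*ʳ _ (mod-* vu≈1 vu≈1) ⟩
        1# * 1# * y (suc k)
          ≃⟨ (solve 1 (λ y → con (+ 1) :* con (+ 1) :* y := y) refl _) ⟩
        y (suc k) ∎ₘ

    -- 12 is the 6 of `∑-quadratic` times the 2 in `y`. The common factor `ι n` remains until
    -- `ljunggren`, where n and 24 have inverses.
    W-mod : ι n * (ι 12 * W) ≈[ 3 ] ι n * (- ((ι n * ι n - 1#) * (ε * ε)))
    W-mod =
      ι n * (ι 12 * W)
        ≃⟨ (solve 2 (λ N W → N :* (con (+ 12) :* W) := con (+ 6) :* (con (+ 2) :* N :* W)) refl (ι n) W) ⟩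
      ι 6 * (ι 2 * ι n * W)
        ∼⟨ mod-*ˡ _ (≈⇒mod (*-distribˡ-∑ n′ _ _)) ⟩
      ι 6 * ∑ n′ (λ j → ι 2 * ι n * (G q n (suc j) * G q n (n′ ∸ j) * q ^ ((n′ ∸ j) ℕ.* (n′ ∸ j))))
        ∼⟨ mod-*ˡ _ (mod-∑ n′ λ j j<n′ → mod-trans
             (≈⇒mod (*-congˡ (*-congʳ (*-congʳ (symmetry j j<n′)))))
             (G²-term (n′ ∸ j) (ℕₚ.m<n⇒0<n∸m j<n′) (s≤s (ℕₚ.m∸n≤m n′ j)))) ⟩
      ι 6 * ∑ n′ (λ j → (ε * ε) * y (n′ ∸ j))
        ≃⟨ (trans (*-congˡ (sym (*-distribˡ-∑ n′ _ _)))
             (solve 3 (λ a e s → a :* (e :* s) := e :* (a :* s)) refl (ι 6) (ε * ε) _)) ⟩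
      (ε * ε) * (ι 6 * ∑ n′ (λ j → y (n′ ∸ j)))
        ∼⟨ mod-lift (I-* Φ∣ε Φ∣ε) ∑y-mod ⟩
      (ε * ε) * - (ι n * (ι n * ι n - 1#))
        ≃⟨ (solve 2 (λ N e → e :* (:- (N :* (N :* N :- con (+ 1)))) := N :* (:- ((N :* N :- con (+ 1)) :* e)))
             refl (ι n) (ε * ε)) ⟩
      ι n * (- ((ι n * ι n - 1#) * (ε * ε))) ∎ₘ
      where
      symmetry : ∀ j → j ℕ.< n′ → G q n (suc j) ≈ G q n (n′ ∸ j)
      symmetry j j<n′ = P.subst (λ m → G q m (suc j) ≈ G q m (n′ ∸ j))
        (P.cong suc (ℕₚ.m+[n∸m]≡n (ℕₚ.<⇒≤ j<n′))) (G-sym q (suc j) (n′ ∸ j))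

    private
      binomial-pascal : ∀ a k → ι (suc a C suc k) ≈ ι (a C k) + ι (a C suc k)
      binomial-pascal a k = trans (reflexive (P.cong ι (P.sym (nCk+nC[k+1]≡[n+1]C[k+1] a k)))) (ι-+ (a C k) (a C suc k))

      binomial-0 : ∀ a → ι (a C 0) ≈ 1#
      binomial-0 a = reflexive (P.cong ι (nC0≡1 a))

    -- The terms beyond j = n vanish. Those for j = 0 and j = n are set apart as the ones whose
    -- factor `G q n j` is 1; for 0 < j < n this factor is a multiple of Φ.
    vandermonde-high : ∀ m r → G q (n ℕ.+ m) (n ℕ.+ r)
      ≈ q ^ (n ℕ.* (n ℕ.+ r)) * G q m (n ℕ.+ r)
        + ∑ n′ (λ j → G q n (suc j) * G q m ((n′ ℕ.+ r) ∸ j) * q ^ ((n′ ∸ j) ℕ.* ((n′ ℕ.+ r) ∸ j)))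
        + G q m r
    vandermonde-high m r = begin
      G q (n ℕ.+ m) (n ℕ.+ r)
        ≈⟨ vandermonde q n m (n ℕ.+ r) ⟩
      ∑ (suc n ℕ.+ r) f
        ≈⟨ ∑-split (suc n) r f ⟩
      ∑ n f + f n + ∑ r (λ i → f (suc n ℕ.+ i))
        ≈⟨ trans (+-congˡ (∑-zero r λ i _ → 0*x*y≈0 _ _ (n<k⇒G≈0 q (s≤s (ℕₚ.m≤m+n n i))))) (+-identityʳ _) ⟩
      ∑ n f + f n
        ≈⟨ +-cong (trans (∑-head n′ f) (+-congʳ first)) last ⟩
      q ^ (n ℕ.* (n ℕ.+ r)) * G q m (n ℕ.+ r) + ∑ n′ (λ j → f (suc j)) + G q m r ∎
      where
      f : ℕ → Carrier
      f j = G q n j * G q m ((n ℕ.+ r) ∸ j) * q ^ ((n ∸ j) ℕ.* ((n ℕ.+ r) ∸ j))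
      first : f 0 ≈ q ^ (n ℕ.* (n ℕ.+ r)) * G q m (n ℕ.+ r)
      first = trans (*-congʳ (*-identityˡ _)) (*-comm _ _)
      last : f n ≈ G q m r
      last = begin
        G q n n * G q m ((n ℕ.+ r) ∸ n) * q ^ ((n ∸ n) ℕ.* ((n ℕ.+ r) ∸ n))
          ≈⟨ *-cong (*-cong (G-self q n) (reflexive (P.cong (G q m) (ℕₚ.m+n∸m≡n n r))))
                    (^-congʳ q (P.cong (ℕ._* ((n ℕ.+ r) ∸ n)) (ℕₚ.n∸n≡0 n))) ⟩
        1# * G q m r * 1#
          ≈⟨ trans (*-identityʳ _) (*-identityˡ _) ⟩
        G q m r ∎

    -- The counterpart for a lower index r < n, where the sum stops before j = n.
    vandermonde-low : ∀ m r → G q (n ℕ.+ m) r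
      ≈ q ^ (n ℕ.* r) * G q m r
        + ∑ r (λ j → G q n (suc j) * G q m (r ∸ suc j) * q ^ ((n′ ∸ j) ℕ.* (r ∸ suc j)))
    vandermonde-low m r = trans (vandermonde q n m r)
      (trans (∑-head r _) (+-congʳ (trans (*-congʳ (*-identityˡ _)) (*-comm _ _))))

    -- A power of q^n differs from 1 by a multiple of Φ, so that erasing it is an error of one order
    -- higher than the term itself.
    drop-power : ∀ k r {x} → I k x → q ^ (n ℕ.* r) * x ≈[ k ℕ.+ 1 ] x
    drop-power k r {x} Ix = mod-trans (≈⇒mod (*-comm _ _))
      (mod-trans (mod-lift Ix (q^[n*k]≈1 r)) (≈⇒mod (*-identityʳ x)))

    I0 : ∀ {x} → I 0 x
    I0 {x} = mkI x (sym (*-identityʳ x))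

    ΦG∣ : ∀ j x e → j ℕ.< n′ → I 1 (G q n (suc j) * x * e)
    ΦG∣ j x e j<n′ = I-resp (solve 3 (λ g x e → (x :* e) :* g := g :* x :* e) refl _ x e)
      (I-scale (x * e) (Φ∣G (suc j) (s≤s z≤n) (s≤s j<n′)))

    Φ²∣GG : ∀ j x e → j ℕ.< n′ → I 1 x → I 2 (G q n (suc j) * x * e)
    Φ²∣GG j x e j<n′ Ix = I-resp (*-comm e _) (I-scale e (I-* (Φ∣G (suc j) (s≤s z≤n) (s≤s j<n′)) Ix))

    step-high : ∀ m r → G q (n ℕ.+ m) (n ℕ.+ r) ≈[ 1 ] G q m (n ℕ.+ r) + G q m r
    step-high m r = mod-trans (≈⇒mod (vandermonde-high m r))
      (mod-+ (mod-trans (+I (I-∑ n′ λ j j<n′ → ΦG∣ j _ _ j<n′)) (drop-power 0 (n ℕ.+ r) I0)) mod-refl)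

    step-low : ∀ m r → r ℕ.< n → G q (n ℕ.+ m) r ≈[ 1 ] G q m r
    step-low m r (s≤s r≤n′) = mod-trans (≈⇒mod (vandermonde-low m r))
      (mod-trans (+I (I-∑ r λ j j<r → ΦG∣ j _ _ (ℕₚ.<-≤-trans j<r r≤n′))) (drop-power 0 r I0))

    -- The case of the q-Lucas theorem with both indices multiples of n: modulo Φ, `step-high` is
    -- the ordinary Pascal rule.
    lucas : ∀ a b → G q (a ℕ.* n) (b ℕ.* n) ≈[ 1 ] ι (a C b)
    lucas a zero = ≈⇒mod (sym (binomial-0 a))
    lucas zero (suc b) = ≈⇒mod (reflexive (P.cong ι (P.sym (0C[1+b]≡0 b))))
    lucas (suc a) (suc b) =
      G q (n ℕ.+ a ℕ.* n) (n ℕ.+ b ℕ.* n)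
        ∼⟨ step-high (a ℕ.* n) (b ℕ.* n) ⟩
      G q (a ℕ.* n) (suc b ℕ.* n) + G q (a ℕ.* n) (b ℕ.* n)
        ∼⟨ mod-+ (lucas a (suc b)) (lucas a b) ⟩
      ι (a C suc b) + ι (a C b)
        ≃⟨ trans (+-comm _ _) (sym (binomial-pascal a b)) ⟩
      ι (suc a C suc b) ∎ₘ

    -- Another case of q-Lucas: the last digits are 0 above and l > 0 below. The recursion is that
    -- of `lucas`, but now it starts from zero.
    Φ∣G-nonmultiple : ∀ a b l → 0 ℕ.< l → l ℕ.< n → I 1 (G q (a ℕ.* n) (b ℕ.* n ℕ.+ l))
    Φ∣G-nonmultiple zero b (suc l) _ _ rewrite ℕₚ.+-suc (b ℕ.* n) l = I-0 refl
    Φ∣G-nonmultiple (suc a) zero l 0<l l<n = I-mod (step-low (a ℕ.* n) l l<n) (Φ∣G-nonmultiple a zero l 0<l l<n)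
    Φ∣G-nonmultiple (suc a) (suc b) l 0<l l<n =
      P.subst (λ k → I 1 (G q (suc a ℕ.* n) k)) (P.sym assoc′)
        (I-mod (step-high (a ℕ.* n) (b ℕ.* n ℕ.+ l)) (I-+
          (P.subst (λ k → I 1 (G q (a ℕ.* n) k)) assoc′ (Φ∣G-nonmultiple a (suc b) l 0<l l<n))
          (Φ∣G-nonmultiple a b l 0<l l<n)))
      where
      assoc′ : n ℕ.+ b ℕ.* n ℕ.+ l ≡ n ℕ.+ (b ℕ.* n ℕ.+ l)
      assoc′ = ℕₚ.+-assoc n (b ℕ.* n) l

    private
      linearWeight-zero : ∀ b → ι (linearWeight 0 b) ≈ 0#
      linearWeight-zero b = reflexive (P.cong ι (P.trans (P.cong (suc b ℕ.*_) (0C[1+b]≡0 b)) (ℕₚ.*-zeroʳ (suc b))))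

      linearWeight-low : ∀ a → ι (linearWeight a 0) + 1# ≈ ι (linearWeight (suc a) 0)
      linearWeight-low a = begin
        ι (linearWeight a 0) + 1#
          ≈⟨ +-cong (reflexive (P.cong ι (ℕₚ.*-identityˡ (a C 1)))) (sym (binomial-0 a)) ⟩
        ι (a C 1) + ι (a C 0)
          ≈⟨ trans (+-comm _ _) (sym (binomial-pascal a 0)) ⟩
        ι (suc a C 1)
          ≡⟨ P.cong ι (ℕₚ.*-identityˡ (suc a C 1)) ⟨
        ι (linearWeight (suc a) 0) ∎

      linearWeight-high : ∀ a b →
        ι (linearWeight a (suc b)) + ι (a C suc b) + ι (linearWeight a b) ≈ ι (linearWeight (suc a) (suc b))
      linearWeight-high a b = begin
        ι (linearWeight a (suc b)) + ι (a C suc b) + ι (linearWeight a b)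
          ≈⟨ +-cong (+-congʳ (trans (ι-* (suc (suc b)) (a C suc (suc b))) (*-congʳ (ι-suc (suc b)))))
                    (ι-* (suc b) (a C suc b)) ⟩
        (1# + ι (suc b)) * ι (a C suc (suc b)) + ι (a C suc b) + ι (suc b) * ι (a C suc b)
          ≈⟨ solve 3 (λ s x y → (con (+ 1) :+ s) :* x :+ y :+ s :* y := (con (+ 1) :+ s) :* (y :+ x)) refl _ _ _ ⟩
        (1# + ι (suc b)) * (ι (a C suc b) + ι (a C suc (suc b)))
          ≈⟨ *-cong (ι-suc (suc b)) (binomial-pascal a (suc b)) ⟨
        ι (suc (suc b)) * ι (suc a C suc (suc b))
          ≈⟨ ι-* (suc (suc b)) (suc a C suc (suc b)) ⟨
        ι (linearWeight (suc a) (suc b)) ∎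

    -- The preceding recursion to one order more. A middle Vandermonde term lies in (Φ²) unless the
    -- lower index of its second factor is a multiple of n. This happens once, at j = l, and there
    -- `lucas` evaluates that factor.
    G-nonmultiple : ∀ a b l → 0 ℕ.< l → l ℕ.< n →
      G q (a ℕ.* n) (b ℕ.* n ℕ.+ l) ≈[ 2 ] ι (linearWeight a b) * G q n l
    G-nonmultiple zero b (suc l) _ _ rewrite ℕₚ.+-suc (b ℕ.* n) l =
      ≈⇒mod (sym (trans (*-congʳ (linearWeight-zero b)) (zeroˡ _)))
    G-nonmultiple (suc a) zero (suc l) 0<l 1+l<n@(s≤s l<n′) =
      G q (n ℕ.+ m) (suc l)
        ≃⟨ vandermonde-low m (suc l) ⟩
      q ^ (n ℕ.* suc l) * G q m (suc l) + (∑ l f + f l)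
        ∼⟨ mod-+ (mod-trans (drop-power 1 (suc l) (Φ∣G-nonmultiple a zero (suc l) 0<l 1+l<n))
                            (G-nonmultiple a zero (suc l) 0<l 1+l<n))
                 (mod-trans (I+ (I-∑ l middle)) (≈⇒mod last)) ⟩
      ι (linearWeight a 0) * G q n (suc l) + G q n (suc l)
        ≃⟨ trans (solve 2 (λ d g → d :* g :+ g := (d :+ con (+ 1)) :* g) refl _ _) (*-congʳ (linearWeight-low a)) ⟩
      ι (linearWeight (suc a) 0) * G q n (suc l) ∎ₘ
      where
      m : ℕ
      m = a ℕ.* n
      f : ℕ → Carrier
      f j = G q n (suc j) * G q m (l ∸ j) * q ^ ((n′ ∸ j) ℕ.* (l ∸ j))
      middle : ∀ j → j ℕ.< l → I 2 (f j)
      middle j j<l = Φ²∣GG j _ _ (ℕₚ.<-trans j<l l<n′)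
        (Φ∣G-nonmultiple a zero (l ∸ j) (ℕₚ.m<n⇒0<n∸m j<l)
          (ℕₚ.≤-<-trans (ℕₚ.m∸n≤m l j) (ℕₚ.m<n⇒m<1+n l<n′)))
      last : f l ≈ G q n (suc l)
      last = begin
        G q n (suc l) * G q m (l ∸ l) * q ^ ((n′ ∸ l) ℕ.* (l ∸ l))
          ≡⟨ P.cong (λ z → G q n (suc l) * G q m z * q ^ ((n′ ∸ l) ℕ.* z)) (ℕₚ.n∸n≡0 l) ⟩
        G q n (suc l) * 1# * q ^ ((n′ ∸ l) ℕ.* 0)
          ≈⟨ *-cong (*-identityʳ _) (^-congʳ q (ℕₚ.*-zeroʳ (n′ ∸ l))) ⟩
        G q n (suc l) * 1#
          ≈⟨ *-identityʳ _ ⟩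
        G q n (suc l) ∎
    G-nonmultiple (suc a) (suc b) (suc l) 0<l 1+l<n@(s≤s l<n′) =
      G q (n ℕ.+ m) (n ℕ.+ b ℕ.* n ℕ.+ suc l)
        ≃⟨ reflexive (P.cong (G q (n ℕ.+ m)) assoc′) ⟩
      G q (n ℕ.+ m) (n ℕ.+ r)
        ≃⟨ vandermonde-high m r ⟩
      q ^ (n ℕ.* (n ℕ.+ r)) * G q m (n ℕ.+ r) + ∑ n′ f + G q m r
        ∼⟨ mod-+ (mod-+ (mod-trans (drop-power 1 (n ℕ.+ r) divisible) ih)
                        (mod-trans (∑-single n′ l l<n′ others) special))
                 (G-nonmultiple a b (suc l) 0<l 1+l<n) ⟩
      ι (linearWeight a (suc b)) * G q n (suc l) + G q n (suc l) * ι (a C suc b) + ι (linearWeight a b) * G q n (suc l)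
        ≃⟨ trans (solve 4 (λ d e c g → d :* g :+ g :* c :+ e :* g := (d :+ c :+ e) :* g) refl _ _ _ _)
                 (*-congʳ (linearWeight-high a b)) ⟩
      ι (linearWeight (suc a) (suc b)) * G q n (suc l) ∎ₘ
      where
      m r : ℕ
      m = a ℕ.* n
      r = b ℕ.* n ℕ.+ suc l
      assoc′ : n ℕ.+ b ℕ.* n ℕ.+ suc l ≡ n ℕ.+ r
      assoc′ = ℕₚ.+-assoc n (b ℕ.* n) (suc l)
      f : ℕ → Carrier
      f j = G q n (suc j) * G q m ((n′ ℕ.+ r) ∸ j) * q ^ ((n′ ∸ j) ℕ.* ((n′ ℕ.+ r) ∸ j))
      divisible : I 1 (G q m (n ℕ.+ r))
      divisible = P.subst (λ k → I 1 (G q m k)) assoc′ (Φ∣G-nonmultiple a (suc b) (suc l) 0<l 1+l<n)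
      ih : G q m (n ℕ.+ r) ≈[ 2 ] ι (linearWeight a (suc b)) * G q n (suc l)
      ih = P.subst (λ k → G q m k ≈[ 2 ] ι (linearWeight a (suc b)) * G q n (suc l)) assoc′
        (G-nonmultiple a (suc b) (suc l) 0<l 1+l<n)
      shift : n′ ℕ.+ r ≡ suc b ℕ.* n ℕ.+ l
      shift = P.trans (P.sym (ℕₚ.+-assoc n′ (b ℕ.* n) (suc l))) (ℕₚ.+-suc (n′ ℕ.+ b ℕ.* n) l)
      others : ∀ j → j ℕ.< n′ → j ≢ l → I 2 (f j)
      others j j<n′ j≢l with j ℕ.<? l
      ... | yes j<l = Φ²∣GG j _ _ j<n′ (P.subst (λ k → I 1 (G q m k)) (P.sym index)
            (Φ∣G-nonmultiple a (suc b) (l ∸ j) (ℕₚ.m<n⇒0<n∸m j<l)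
              (ℕₚ.≤-<-trans (ℕₚ.m∸n≤m l j) (ℕₚ.m<n⇒m<1+n l<n′))))
        where
        index : (n′ ℕ.+ r) ∸ j ≡ suc b ℕ.* n ℕ.+ (l ∸ j)
        index = P.trans (P.cong (_∸ j) shift) (ℕₚ.+-∸-assoc (suc b ℕ.* n) (ℕₚ.<⇒≤ j<l))
      -- Past j = l the lower index falls under (b + 1) n. Its remainder n′ - j + l + 1 is smaller
      -- than n because l < j.
      ... | no j≮l = Φ²∣GG j _ _ j<n′ (P.subst (λ k → I 1 (G q m k)) (P.sym index)
            (Φ∣G-nonmultiple a b ((n′ ∸ j) ℕ.+ suc l) (ℕₚ.≤-trans (ℕₚ.m<n⇒0<n∸m j<n′) (ℕₚ.m≤m+n _ _)) bound))
        where
        l<j : l ℕ.< j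
        l<j = ℕₚ.≤∧≢⇒< (ℕₚ.≮⇒≥ j≮l) (λ l≡j → j≢l (P.sym l≡j))
        bound : (n′ ∸ j) ℕ.+ suc l ℕ.< n
        bound = s≤s (ℕₚ.≤-trans (ℕₚ.+-monoʳ-≤ (n′ ∸ j) l<j) (ℕₚ.≤-reflexive (ℕₚ.m∸n+n≡m (ℕₚ.<⇒≤ j<n′))))
        index : (n′ ℕ.+ r) ∸ j ≡ b ℕ.* n ℕ.+ ((n′ ∸ j) ℕ.+ suc l)
        index = P.trans (ℕₚ.+-∸-comm r (ℕₚ.<⇒≤ j<n′)) (x∙yz≈y∙xz (n′ ∸ j) (b ℕ.* n) (suc l))
      special : f l ≈[ 2 ] G q n (suc l) * ι (a C suc b)
      special =
        f l
          ≃⟨ reflexive (P.cong (λ k → G q n (suc l) * G q m k * q ^ ((n′ ∸ l) ℕ.* k))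
                         (P.trans (P.cong (_∸ l) shift) (ℕₚ.m+n∸n≡m (suc b ℕ.* n) l))) ⟩
        G q n (suc l) * G q m (suc b ℕ.* n) * q ^ ((n′ ∸ l) ℕ.* (suc b ℕ.* n))
          ≃⟨ trans (*-assoc _ _ _) (*-congˡ (*-congˡ (^-congʳ q (P.sym (ℕₚ.*-assoc (n′ ∸ l) (suc b) n))))) ⟩
        G q n (suc l) * (G q m (suc b ℕ.* n) * q ^ ((n′ ∸ l) ℕ.* suc b ℕ.* n))
          ∼⟨ mod-lift (Φ∣G (suc l) 0<l 1+l<n)
               (mod-trans (mod-* (lucas a (suc b)) (q^[k*n]≈1 ((n′ ∸ l) ℕ.* suc b))) (≈⇒mod (*-identityʳ _))) ⟩
        G q n (suc l) * ι (a C suc b) ∎ₘ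

    private
      -- The linear weight occurs twice, which is why the error in `G-multiple` is measured by half
      -- of `W`.
      quadraticWeight-step : ∀ a b →
        ι (quadraticWeight a (suc b)) + (ι (linearWeight a b) + ι (linearWeight a b)) + ι (quadraticWeight a b)
          ≈ ι (quadraticWeight (suc a) (suc b))
      quadraticWeight-step a b = begin
        ι (quadraticWeight a (suc b)) + (ι (linearWeight a b) + ι (linearWeight a b)) + ι (quadraticWeight a b)
          ≈⟨ +-cong (+-congʳ (trans (ι-* (suc b) (linearWeight a (suc b))) (*-congʳ (ι-suc b))))
                    (ι-* b (linearWeight a b)) ⟩
        (1# + ι b) * ι (linearWeight a (suc b)) + (ι (linearWeight a b) + ι (linearWeight a b)) + ι b * ι (linearWeight a b)
          ≈⟨ solve 3 (λ s x y → (con (+ 1) :+ s) :* x :+ (y :+ y) :+ s :* y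
               := (con (+ 1) :+ s) :* (x :+ y) :+ y) refl (ι b) _ (ι (linearWeight a b)) ⟩
        (1# + ι b) * (ι (linearWeight a (suc b)) + ι (linearWeight a b)) + ι (linearWeight a b)
          ≈⟨ +-congˡ (trans (ι-* (suc b) (a C suc b)) (*-congʳ (ι-suc b))) ⟩
        (1# + ι b) * (ι (linearWeight a (suc b)) + ι (linearWeight a b)) + (1# + ι b) * ι (a C suc b)
          ≈⟨ solve 4 (λ s x y c → s :* (x :+ y) :+ s :* c := s :* (x :+ c :+ y)) refl (1# + ι b) _ _ _ ⟩
        (1# + ι b) * (ι (linearWeight a (suc b)) + ι (a C suc b) + ι (linearWeight a b))
          ≈⟨ *-cong (sym (ι-suc b)) (linearWeight-high a b) ⟩
        ι (suc b) * ι (linearWeight (suc a) (suc b))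
          ≈⟨ ι-* (suc b) (linearWeight (suc a) (suc b)) ⟨
        ι (quadraticWeight (suc a) (suc b)) ∎

    -- Both binomials of a term are multiples of Φ. Hence the power of q matters only modulo Φ and
    -- the second binomial only modulo Φ².
    middle-sum : ∀ a b →
      ∑ n′ (λ j → G q n (suc j) * G q (a ℕ.* n) ((n′ ℕ.+ b ℕ.* n) ∸ j) * q ^ ((n′ ∸ j) ℕ.* ((n′ ℕ.+ b ℕ.* n) ∸ j)))
        ≈[ 3 ] ι (linearWeight a b) * W
    middle-sum a b = mod-trans (mod-∑ n′ term) (≈⇒mod (sym (*-distribˡ-∑ n′ _ _)))
      where
      m : ℕ
      m = a ℕ.* n
      term : ∀ j → j ℕ.< n′ →
        G q n (suc j) * G q m ((n′ ℕ.+ b ℕ.* n) ∸ j) * q ^ ((n′ ∸ j) ℕ.* ((n′ ℕ.+ b ℕ.* n) ∸ j))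
             ≈[ 3 ] ι (linearWeight a b) * (G q n (suc j) * G q n (n′ ∸ j) * q ^ ((n′ ∸ j) ℕ.* (n′ ∸ j)))
      term j j<n′ =
        g * G q m ((n′ ℕ.+ b ℕ.* n) ∸ j) * q ^ (l ℕ.* ((n′ ℕ.+ b ℕ.* n) ∸ j))
          ≃⟨ reflexive (P.cong (λ k → g * G q m k * q ^ (l ℕ.* k))
                         (P.trans (ℕₚ.+-∸-comm (b ℕ.* n) (ℕₚ.<⇒≤ j<n′)) (ℕₚ.+-comm l (b ℕ.* n)))) ⟩
        g * G q m (b ℕ.* n ℕ.+ l) * q ^ (l ℕ.* (b ℕ.* n ℕ.+ l))
          ∼⟨ mod-lift (I-* Ig (Φ∣G-nonmultiple a b l 0<l l<n)) power ⟩
        g * G q m (b ℕ.* n ℕ.+ l) * q ^ (l ℕ.* l)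
          ∼⟨ mod-*ʳ _ (mod-lift Ig (G-nonmultiple a b l 0<l l<n)) ⟩
        g * (ι (linearWeight a b) * G q n l) * q ^ (l ℕ.* l)
          ≃⟨ solve 4 (λ g d h p → g :* (d :* h) :* p := d :* (g :* h :* p)) refl _ _ _ _ ⟩
        ι (linearWeight a b) * (g * G q n l * q ^ (l ℕ.* l)) ∎ₘ
        where
        g : Carrier
        g = G q n (suc j)
        l : ℕ
        l = n′ ∸ j
        0<l : 0 ℕ.< l
        0<l = ℕₚ.m<n⇒0<n∸m j<n′
        l<n : l ℕ.< n
        l<n = s≤s (ℕₚ.m∸n≤m n′ j)
        Ig : I 1 g
        Ig = Φ∣G (suc j) (s≤s z≤n) (s≤s j<n′)
        power : q ^ (l ℕ.* (b ℕ.* n ℕ.+ l)) ≈[ 1 ] q ^ (l ℕ.* l)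
        power =
          q ^ (l ℕ.* (b ℕ.* n ℕ.+ l))
            ≃⟨ trans (^-congʳ q (ℕₚ.*-distribˡ-+ l (b ℕ.* n) l)) (^-homo-* q (l ℕ.* (b ℕ.* n)) _) ⟩
          q ^ (l ℕ.* (b ℕ.* n)) * q ^ (l ℕ.* l)
            ∼⟨ mod-*ʳ _ (mod-trans (≈⇒mod (^-congʳ q (P.sym (ℕₚ.*-assoc l b n)))) (q^[k*n]≈1 (l ℕ.* b))) ⟩
          1# * q ^ (l ℕ.* l)
            ≃⟨ *-identityˡ _ ⟩
          q ^ (l ℕ.* l) ∎ₘ

    -- Induction on `a`. The factor q^(n (n + r)) is kept on the main term as a Pascal coefficient
    -- and erased from the error, which lies in (Φ²). Half of `W` is an argument because 2 is not
    -- yet invertible.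
    G-multiple : ∀ w → I 2 w → W ≈[ 3 ] w + w → ∀ a b →
      G q (a ℕ.* n) (b ℕ.* n) ≈[ 3 ] G (q ^ (n ℕ.* n)) a b + ι (quadraticWeight a b) * w
    G-multiple w Iw W≈2w a zero = ≈⇒mod (solve 1 (λ w → con (+ 1) := con (+ 1) :+ con (+ 0) :* w) refl w)
    G-multiple w Iw W≈2w zero (suc b) = ≈⇒mod (sym (trans (+-identityˡ _) (trans (*-congʳ quadraticWeight≈0) (zeroˡ w))))
      where
      quadraticWeight≈0 : ι (quadraticWeight 0 (suc b)) ≈ 0#
      quadraticWeight≈0 = trans (ι-* (suc b) (linearWeight 0 (suc b)))
        (trans (*-congˡ (linearWeight-zero (suc b))) (zeroʳ _))
    G-multiple w Iw W≈2w (suc a) (suc b) =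
      G q (n ℕ.+ m) (n ℕ.+ r)
        ≃⟨ vandermonde-high m r ⟩
      q ^ (n ℕ.* (n ℕ.+ r)) * G q m (n ℕ.+ r) + ∑ n′ _ + G q m r
        ∼⟨ mod-+ (mod-+ (mod-*ˡ _ (G-multiple w Iw W≈2w a (suc b)))
                        (mod-trans (middle-sum a b) (mod-*ˡ _ W≈2w)))
                 (G-multiple w Iw W≈2w a b) ⟩
      q ^ (n ℕ.* (n ℕ.+ r)) * (G Q a (suc b) + ι (quadraticWeight a (suc b)) * w)
        + ι (linearWeight a b) * (w + w) + (G Q a b + ι (quadraticWeight a b) * w)
        ≃⟨ +-congʳ (+-congʳ (distribˡ _ _ _)) ⟩
      q ^ (n ℕ.* (n ℕ.+ r)) * G Q a (suc b) + q ^ (n ℕ.* (n ℕ.+ r)) * (ι (quadraticWeight a (suc b)) * w)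
        + ι (linearWeight a b) * (w + w) + (G Q a b + ι (quadraticWeight a b) * w)
        ∼⟨ mod-+ (mod-+ (mod-+ (≈⇒mod (*-congʳ power)) (drop-power 2 (n ℕ.+ r) (I-scale _ Iw))) mod-refl) mod-refl ⟩
      Q ^ suc b * G Q a (suc b) + ι (quadraticWeight a (suc b)) * w
        + ι (linearWeight a b) * (w + w) + (G Q a b + ι (quadraticWeight a b) * w)
        ≃⟨ solve 6 (λ A e d B e′ w → A :+ e :* w :+ d :* (w :+ w) :+ (B :+ e′ :* w)
               := (B :+ A) :+ (e :+ (d :+ d) :+ e′) :* w) refl _ _ _ _ _ w ⟩
      G Q (suc a) (suc b)
        + (ι (quadraticWeight a (suc b)) + (ι (linearWeight a b) + ι (linearWeight a b)) + ι (quadraticWeight a b)) * w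
        ≃⟨ +-congˡ (*-congʳ (quadraticWeight-step a b)) ⟩
      G Q (suc a) (suc b) + ι (quadraticWeight (suc a) (suc b)) * w ∎ₘ
      where
      m r : ℕ
      m = a ℕ.* n
      r = b ℕ.* n
      Q : Carrier
      Q = q ^ (n ℕ.* n)
      power : q ^ (n ℕ.* (n ℕ.+ r)) ≈ Q ^ suc b
      power = trans (^-congʳ q (P.trans (P.cong (n ℕ.*_) (ℕₚ.*-comm (suc b) n)) (P.sym (ℕₚ.*-assoc n n (suc b)))))
                    (sym (^-assocʳ q (n ℕ.* n) (suc b)))

    -- The rational coefficient is represented by any `c` with the right value of 24 c, which keeps
    -- fractions out of the abstract ring.
    ljunggren : ∀ {n⁻¹ t} → ι n * n⁻¹ ≈ 1# → ι 24 * t ≈ 1# → ∀ a b c →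
      ι 24 * c ≈ ι (quadraticWeight a b) * (ι n * ι n - 1#) →
      G q (a ℕ.* n) (b ℕ.* n) ≈[ 3 ] G (q ^ (n ℕ.* n)) a b - c * (ε * ε)
    ljunggren {n⁻¹} {t} nn⁻¹≈1 24t≈1 a b c 24c≈ =
      G q (a ℕ.* n) (b ℕ.* n)
        ∼⟨ G-multiple w (I-neg (I-scale _ (I-* Φ∣ε Φ∣ε))) W≈2w a b ⟩
      G (q ^ (n ℕ.* n)) a b + ι (quadraticWeight a b) * w
        ≃⟨ +-congˡ (begin
          ι (quadraticWeight a b) * - (N * t * (ε * ε))
            ≈⟨ solve 4 (λ e N t x → e :* (:- (N :* t :* x)) := :- (t :* (e :* N) :* x)) refl _ N t (ε * ε) ⟩
          - (t * (ι (quadraticWeight a b) * N) * (ε * ε))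
            ≈⟨ -‿cong (*-congʳ (*-congˡ (sym 24c≈))) ⟩
          - (t * (ι 24 * c) * (ε * ε))
            ≈⟨ solve 4 (λ t k c x → :- (t :* (k :* c) :* x) := :- ((k :* t) :* c :* x)) refl t (ι 24) c (ε * ε) ⟩
          - (ι 24 * t * c * (ε * ε))
            ≈⟨ -‿cong (*-congʳ (trans (*-congʳ 24t≈1) (*-identityˡ c))) ⟩
          - (c * (ε * ε)) ∎) ⟩
      G (q ^ (n ℕ.* n)) a b - c * (ε * ε) ∎ₘ
      where
      N w : Carrier
      N = ι n * ι n - 1#
      -- With `t` for 1 / 24 this is half of -(n² - 1) ε² / 12.
      w = - (N * t * (ε * ε))
      cancel : ∀ x → n⁻¹ * (ι 2 * t) * (ι n * (ι 12 * x)) ≈ x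
      cancel x = begin
        n⁻¹ * (ι 2 * t) * (ι n * (ι 12 * x))
          ≈⟨ solve 4 (λ i t N x → i :* (con (+ 2) :* t) :* (N :* (con (+ 12) :* x))
               := (N :* i) :* (con (+ 24) :* t) :* x) refl n⁻¹ t (ι n) x ⟩
        ι n * n⁻¹ * (ι 24 * t) * x
          ≈⟨ *-congʳ (*-cong nn⁻¹≈1 24t≈1) ⟩
        1# * 1# * x
          ≈⟨ trans (*-congʳ (*-identityˡ 1#)) (*-identityˡ x) ⟩
        x ∎
      W≈2w : W ≈[ 3 ] w + w
      W≈2w =
        W
          ≃⟨ sym (cancel W) ⟩
        n⁻¹ * (ι 2 * t) * (ι n * (ι 12 * W))
          ∼⟨ mod-*ˡ _ W-mod ⟩
        n⁻¹ * (ι 2 * t) * (ι n * - (N * (ε * ε)))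
          ≃⟨ solve 5 (λ i t n N x → i :* (con (+ 2) :* t) :* (n :* (:- (N :* x)))
               := (n :* i) :* (:- (N :* t :* x) :+ :- (N :* t :* x))) refl n⁻¹ t (ι n) N (ε * ε) ⟩
        (ι n * n⁻¹) * (w + w)
          ≃⟨ trans (*-congʳ nn⁻¹≈1) (*-identityˡ _) ⟩
        w + w ∎ₘ

-- Comaximality of cyclotomic factors

module Cyclotomic (R : CommutativeRing 0ℓ 0ℓ) (q : CommutativeRing.Carrier R)
  (Φ : ℕ → CommutativeRing.Carrier R) where

  open CommutativeRing R hiding (zero)
  open import Algebra.Properties.CommutativeSemiring.Exp commutativeSemiring
  open import Algebra.Properties.CommutativeSemigroup.Divisibility *-commutativeSemigroup
    using (_∣_; _,_; ∣ʳ-trans; ∣ʳ-respˡ-≈; ∙-cong-∣; x∣xy)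
  open import Relation.Binary.Reasoning.Setoid setoid
  open IntegerSolver R
  open GaussianBinomials R

  Comaximal : Carrier → Carrier → Set
  Comaximal x y = ∃₂ λ u v → u * x + v * y ≈ 1#

  comaximal-sym : ∀ {x y} → Comaximal x y → Comaximal y x
  comaximal-sym (u , v , e) = v , u , trans (+-comm _ _) e

  comaximal-∣ : ∀ {x y z} → z ∣ y → Comaximal x y → Comaximal x z
  comaximal-∣ (h , hz≈y) (u , v , e) =
    u , v * h , trans (+-congˡ (trans (*-assoc v h _) (*-congˡ hz≈y))) e

  comaximal-* : ∀ {x y z} → Comaximal x z → Comaximal y z → Comaximal (x * y) z
  comaximal-* {x} {y} {z} (u , v , e) (u′ , v′ , e′) =
    u * u′ , u * x * v′ + v * (u′ * y + v′ * z) , (begin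
      u * u′ * (x * y) + (u * x * v′ + v * (u′ * y + v′ * z)) * z
        ≈⟨ solve 7 (λ x y z u v u′ v′ → u :* u′ :* (x :* y) :+ (u :* x :* v′ :+ v :* (u′ :* y :+ v′ :* z)) :* z
             := (u :* x :+ v :* z) :* (u′ :* y :+ v′ :* z)) refl x y z u v u′ v′ ⟩
      (u * x + v * z) * (u′ * y + v′ * z)   ≈⟨ *-cong e e′ ⟩
      1# * 1#                               ≈⟨ *-identityˡ 1# ⟩
      1#                                    ∎)

  comaximal-1 : ∀ z → Comaximal 1# z
  comaximal-1 z = 1# , 0# , solve 1 (λ z → con (+ 1) :* con (+ 1) :+ con (+ 0) :* z := con (+ 1)) refl z

  comaximal-∣-* : ∀ {x y w} → Comaximal x y → x ∣ w → y ∣ w → x * y ∣ w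
  comaximal-∣-* {x} {y} {w} (u , v , e) (a , ax≈w) (b , by≈w) = u * b + v * a , (begin
    (u * b + v * a) * (x * y)
      ≈⟨ solve 6 (λ x y u v a b → (u :* b :+ v :* a) :* (x :* y) := u :* x :* (b :* y) :+ v :* y :* (a :* x)) refl x y u v a b ⟩
    u * x * (b * y) + v * y * (a * x)   ≈⟨ +-cong (*-congˡ by≈w) (*-congˡ ax≈w) ⟩
    u * x * w + v * y * w               ≈⟨ distribʳ w _ _ ⟨
    (u * x + v * y) * w                 ≈⟨ *-congʳ e ⟩
    1# * w                              ≈⟨ *-identityˡ w ⟩
    w                                   ∎)

  x-1∣x^m-1 : ∀ x m → (x - 1#) * ∑ m (x ^_) ≈ x ^ m - 1#
  x-1∣x^m-1 x m = begin
    (x - 1#) * ∑ m (x ^_)      ≈⟨ solve 2 (λ x s → (x :- con (+ 1)) :* s := :- ((con (+ 1) :- x) :* s)) refl x _ ⟩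
    - ((1# - x) * ∑ m (x ^_))  ≈⟨ -‿cong (geometric x m) ⟩
    - (1# - x ^ m)             ≈⟨ solve 1 (λ p → :- (con (+ 1) :- p) := p :- con (+ 1)) refl _ ⟩
    x ^ m - 1#                 ∎

  ∑-powers-at-1 : ∀ x m → ∃ λ t → ∑ m (x ^_) ≈ ι m + t * (x - 1#)
  ∑-powers-at-1 x zero = 0# , sym (trans (+-identityˡ _) (zeroˡ _))
  ∑-powers-at-1 x (suc m) with (t , e) ← ∑-powers-at-1 x m = t + ∑ m (x ^_) , (begin
    ∑ m (x ^_) + x ^ m
      ≈⟨ +-cong e (solve 1 (λ p → p := con (+ 1) :+ (p :- con (+ 1))) refl _) ⟩
    (ι m + t * (x - 1#)) + (1# + (x ^ m - 1#))
      ≈⟨ +-congˡ (+-congˡ (trans (sym (x-1∣x^m-1 x m)) (*-comm _ _))) ⟩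
    (ι m + t * (x - 1#)) + (1# + ∑ m (x ^_) * (x - 1#))
      ≈⟨ solve 4 (λ i t x s → (i :+ t :* x) :+ (con (+ 1) :+ s :* x) := (con (+ 1) :+ i) :+ (t :+ s) :* x) refl _ _ _ _ ⟩
    (1# + ι m) + (t + ∑ m (x ^_)) * (x - 1#)
      ≈⟨ +-congʳ (sym (ι-suc m)) ⟩
    ι (suc m) + (t + ∑ m (x ^_)) * (x - 1#) ∎)

  u : ℕ → Carrier
  u k = q ^ k - 1#

  u-∣ : ∀ {g k} → g ℕ∣.∣ k → u g ∣ u k
  u-∣ {g} (ℕ∣.divides m P.refl) = ∑ m ((q ^ g) ^_) , trans (*-comm _ _)
    (trans (x-1∣x^m-1 (q ^ g) m) (+-congʳ (trans (^-assocʳ q g m) (^-congʳ q (ℕₚ.*-comm g m)))))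

  -- For b = g + a one has q^g - 1 = (q^b - 1) - q^g (q^a - 1). Bézout's identity in ℕ provides `a`
  -- and `b` as multiples of the two given exponents.
  u-linear : ∀ {g} a b {e k} → g ℕ.+ a ≡ b → u e ∣ u a → u k ∣ u b → ∃₂ λ α β → u g ≈ α * u e + β * u k
  u-linear {g} a b {e} {k} eq (s , s≈) (t , t≈) = - (q ^ g * s) , t , (begin
    q ^ g - 1#
      ≈⟨ solve 2 (λ a b → a :- con (+ 1) := :- (a :* (b :- con (+ 1))) :+ (a :* b :- con (+ 1))) refl (q ^ g) (q ^ a) ⟩
    - (q ^ g * u a) + (q ^ g * q ^ a - 1#)
      ≈⟨ +-congˡ (+-congʳ (trans (sym (^-homo-* q g a)) (^-congʳ q eq))) ⟩
    - (q ^ g * u a) + u b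
      ≈⟨ +-cong (-‿cong (*-congˡ (sym s≈))) (sym t≈) ⟩
    - (q ^ g * (s * u e)) + t * u k
      ≈⟨ +-congʳ (solve 3 (λ a s e → :- (a :* (s :* e)) := :- (a :* s) :* e) refl _ _ _) ⟩
    - (q ^ g * s) * u e + t * u k ∎)

  u-bezout : ∀ {g k e} → Bézout.Identity g k e → ∃₂ λ α β → u g ≈ α * u e + β * u k
  u-bezout {g} {k} {e} (Bézout.Identity.+- x y eq) =
    u-linear {g} (y ℕ.* e) (x ℕ.* k) {e} {k} eq (u-∣ (ℕ∣.n∣m*n y)) (u-∣ (ℕ∣.n∣m*n x))
  u-bezout {g} {k} {e} (Bézout.Identity.-+ x y eq) =
    let (α , β , e′) = u-linear {g} (x ℕ.* k) (y ℕ.* e) {k} {e} eq (u-∣ (ℕ∣.n∣m*n x)) (u-∣ (ℕ∣.n∣m*n y))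
    in β , α , trans e′ (+-comm _ _)

  choose : ∀ {A : Set} → Dec A → Carrier → Carrier
  choose d x = if does d then x else 1#

  factor : ℕ → ℕ → Carrier
  factor N d = choose (d ℕ∣.∣? N) (Φ d)

  -- The product of `Φ d` over the divisors d ≤ m of N. A nondivisor contributes 1, so that
  -- divisibility between such products can be checked factor by factor. `Π (suc n) n` is the
  -- divisor in the definition of `Φ (suc n)`.
  Π : ℕ → ℕ → Carrier
  Π N zero = 1#
  Π N (suc m) = Π N m * factor N (suc m)

  choose-yes : ∀ {A : Set} (d : Dec A) x → A → choose d x ≡ x
  choose-yes (yes _) x a = P.refl
  choose-yes (no ¬a) x a = contradiction a ¬a

  choose-mono : ∀ {A B : Set} (d : Dec A) (d′ : Dec B) x → (A → B) → choose d x ∣ choose d′ x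
  choose-mono (yes a) (yes b) x f = 1# , *-identityˡ _
  choose-mono (yes a) (no ¬b) x f = contradiction (f a) ¬b
  choose-mono (no ¬a) d′ x f = choose d′ x , *-identityʳ _

  factor-self : ∀ N → factor N N ≡ Φ N
  factor-self N = choose-yes (N ℕ∣.∣? N) (Φ N) ℕ∣.∣-refl

  factor-∣ : ∀ {g e} → g ℕ∣.∣ e → ∀ d → factor g d ∣ factor e d
  factor-∣ {g} {e} g∣e d = choose-mono (d ℕ∣.∣? g) (d ℕ∣.∣? e) (Φ d) (λ d∣g → ℕ∣.∣-trans d∣g g∣e)

  Π-∣ : ∀ {g e} → g ℕ∣.∣ e → ∀ m → Π g m ∣ Π e m
  Π-∣ g∣e zero = 1# , *-identityˡ _
  Π-∣ g∣e (suc m) = ∙-cong-∣ (Π-∣ g∣e m) (factor-∣ g∣e (suc m))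

  Π-mono-∣ : ∀ e {m k} → m ℕ.≤′ k → Π e m ∣ Π e k
  Π-mono-∣ e ℕ.≤′-refl = 1# , *-identityˡ _
  Π-mono-∣ e (ℕ.≤′-step m≤k) = ∣ʳ-trans (Π-mono-∣ e m≤k) (x∣xy _ _)

  module _ (invertible : ∀ m → ∃ λ r → r * ι (suc m) ≈ 1#)
           (regular : ∀ g {x y} → u (suc g) * x ≈ u (suc g) * y → x ≈ y)
           -- The contract of the division that defines Φ: the quotient is a true one as soon as the
           -- divisor divides. The smaller factorisations may be used, since they control the
           -- constant term of the divisor.
           (exact : ∀ N → (∀ {d} → d ℕ.< N → Π (suc d) d * Φ (suc d) ≈ u (suc d)) →
                    Π (suc N) N ∣ u (suc N) → Π (suc N) N * Φ (suc N) ≈ u (suc N))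
    where

    Factors : ℕ → Set
    Factors d = Π (suc d) (suc d) ≈ u (suc d)

    Π*Φ≈u : ∀ d → Factors d → Π (suc d) d * Φ (suc d) ≈ u (suc d)
    Π*Φ≈u d = trans (*-congˡ (reflexive (P.sym (factor-self (suc d)))))

    Φ∣u : ∀ d → Factors d → Φ (suc d) ∣ u (suc d)
    Φ∣u d f = Π (suc d) d , Π*Φ≈u d f

    private
      -- Both (q^g - 1) times the sum and (q^g - 1) r Φ equal q^e - 1, with g and e for the
      -- successors; the common factor is cancelled by `regular`.
      Φ∣quotient : ∀ e g m → suc e ≡ m ℕ.* suc g → u (suc g) ∣ Π (suc e) e → Factors e →
        Φ (suc e) ∣ ∑ m ((q ^ suc g) ^_)
      Φ∣quotient e g m eq (r , r*ug≈Π) f = r , sym (regular g (begin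
        u (suc g) * ∑ m ((q ^ suc g) ^_)
          ≈⟨ trans (x-1∣x^m-1 (q ^ suc g) m) (+-congʳ (trans (^-assocʳ q (suc g) m)
               (^-congʳ q (P.trans (ℕₚ.*-comm (suc g) m) (P.sym eq))))) ⟩
        u (suc e)                       ≈⟨ Π*Φ≈u e f ⟨
        Π (suc e) e * Φ (suc e)         ≈⟨ *-congʳ r*ug≈Π ⟨
        r * u (suc g) * Φ (suc e)       ≈⟨ solve 3 (λ r x f → r :* x :* f := x :* (r :* f)) refl r _ _ ⟩
        u (suc g) * (r * Φ (suc e))     ∎))

      -- Modulo `v`, x is α p φ, and M = r φ then gives N = (r - t α p) φ. Since N is a unit, φ is
      -- invertible modulo `v`.
      comaximal-combine : ∀ {M N t x α w β v p φ i} → φ ∣ M → M ≈ N + t * x → x ≈ α * w + β * v →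
        p * φ ≈ w → i * N ≈ 1# → Comaximal φ v
      comaximal-combine {M} {N} {t} {x} {α} {w} {β} {v} {p} {φ} {i} (r , rφ≈M) M≈ x≈ pφ≈w iN≈1 =
        i * (r - t * α * p) , - (i * t * β) , (begin
          i * (r - t * α * p) * φ + - (i * t * β) * v
            ≈⟨ solve 6 (λ i r a p f b → i :* (r :- a :* p) :* f :+ b
               := i :* (r :* f :- a :* (p :* f)) :+ b) refl i r (t * α) p φ _ ⟩
          i * (r * φ - t * α * (p * φ)) + - (i * t * β) * v
            ≈⟨ +-congʳ (*-congˡ (+-cong (trans rφ≈M M≈) (-‿cong (*-congˡ pφ≈w)))) ⟩
          i * ((N + t * x) - t * α * w) + - (i * t * β) * v
            ≈⟨ +-congʳ (*-congˡ (+-congʳ (+-congˡ (*-congˡ x≈)))) ⟩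
          i * ((N + t * (α * w + β * v)) - t * α * w) + - (i * t * β) * v
            ≈⟨ solve 7 (λ i N t a w b v → i :* ((N :+ t :* (a :* w :+ b :* v)) :- t :* a :* w) :+ :- (i :* t :* b) :* v
                          := i :* N) refl i N t α w β v ⟩
          i * N   ≈⟨ iN≈1 ⟩
          1#      ∎)

    -- With g = gcd k e, Φ e divides (q ^ e - 1) / (q ^ g - 1), which is e / g modulo q ^ g - 1.
    comaximal-Φ-u : ∀ e → (∀ {d} → d ℕ.≤ e → Factors d) →
      ∀ k → ¬ (suc e ℕ∣.∣ k) → Comaximal (Φ (suc e)) (u k)
    comaximal-Φ-u e factors k e∤k =
      go (gcd k (suc e)) (gcd[m,n]∣m k (suc e)) (gcd[m,n]∣n k (suc e)) (Bézout.identity (gcd-GCD k (suc e)))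
      where
      go : ∀ g → g ℕ∣.∣ k → g ℕ∣.∣ suc e → Bézout.Identity g k (suc e) → Comaximal (Φ (suc e)) (u k)
      go zero g∣k g∣e bezout = contradiction (ℕ∣.0∣⇒≡0 g∣e) (λ ())
      go (suc g) g∣k (ℕ∣.divides zero ()) bezout
      go (suc g) g∣k g∣e@(ℕ∣.divides (suc m) eq) bezout =
        let (_ , M≈) = ∑-powers-at-1 (q ^ suc g) (suc m)
            (_ , i*m≈1) = invertible m
            (_ , _ , ug≈) = u-bezout bezout
        in comaximal-combine (Φ∣quotient e g (suc m) eq ug∣Π (factors ℕₚ.≤-refl)) M≈ ug≈
             (Π*Φ≈u e (factors ℕₚ.≤-refl)) i*m≈1
        where
        1+g≤e : suc g ℕ.≤ e
        1+g≤e = ℕₚ.≤-pred (ℕₚ.≤∧≢⇒< (ℕ∣.∣⇒≤ g∣e) (λ g≡e → e∤k (P.subst (ℕ∣._∣ k) g≡e g∣k)))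
        -- Divisors of the gcd are divisors of `suc e` not exceeding `e`, so that all factors of q^g
        -- - 1 occur among the proper factors.
        ug∣Π : u (suc g) ∣ Π (suc e) e
        ug∣Π = ∣ʳ-respˡ-≈ (factors (ℕₚ.<⇒≤ 1+g≤e))
          (∣ʳ-trans (Π-∣ g∣e (suc g)) (Π-mono-∣ (suc e) (ℕₚ.≤⇒≤′ 1+g≤e)))

    -- For d ≤ m, `Φ d` divides q^d - 1, and m + 1 is too large to divide d.
    comaximal-Π : ∀ N m k → (∀ {d} → d ℕ.≤ m → Factors d) → k ℕ.≤ m → Comaximal (Π N k) (Φ (suc m))
    comaximal-Π N m zero factors k≤m = comaximal-1 _
    comaximal-Π N m (suc k) factors k<m =
      comaximal-* (comaximal-Π N m k factors (ℕₚ.<⇒≤ k<m)) (last (suc k ℕ∣.∣? N))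
      where
      last : ∀ {A : Set} (d : Dec A) → Comaximal (choose d (Φ (suc k))) (Φ (suc m))
      last (no _) = comaximal-1 _
      last (yes _) = comaximal-sym (comaximal-∣ (Φ∣u k (factors (ℕₚ.<⇒≤ k<m)))
        (comaximal-Φ-u m factors (suc k) (ℕ∣.>⇒∤ (s≤s k<m))))

    -- Each factor divides q^N - 1, and comaximality passes this on to the product, in place of
    -- unique factorisation.
    Π∣u : ∀ N m → (∀ {d} → d ℕ.< m → Factors d) → Π N m ∣ u N
    Π∣u N zero factors = u N , *-identityʳ _
    Π∣u N (suc m) factors = comaximal-∣-* comaximal ih (last (suc m ℕ∣.∣? N))
      where
      ih : Π N m ∣ u N
      ih = Π∣u N m λ d<m → factors (ℕₚ.m<n⇒m<1+n d<m)
      last : (d : Dec (suc m ℕ∣.∣ N)) → choose d (Φ (suc m)) ∣ u N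
      last (no _) = u N , *-identityʳ _
      last (yes m∣N) = ∣ʳ-trans (Φ∣u m (factors ℕₚ.≤-refl)) (u-∣ m∣N)
      comaximal : Comaximal (Π N m) (factor N (suc m))
      comaximal = comaximal-sym (go (suc m ℕ∣.∣? N))
        where
        go : (d : Dec (suc m ℕ∣.∣ N)) → Comaximal (choose d (Φ (suc m))) (Π N m)
        go (no _) = comaximal-1 _
        go (yes _) = comaximal-sym (comaximal-Π N m m (λ d≤m → factors (s≤s d≤m)) ℕₚ.≤-refl)

    -- Strong induction as structural recursion on a bound. The earlier cases serve twice: for the
    -- divisibility and for the division.
    factors< : ∀ N {d} → d ℕ.< N → Factors d
    factors< (suc N) {d} (s≤s d≤N) = trans (*-congˡ (reflexive (factor-self (suc d))))
      (exact d (λ c<d → Π*Φ≈u _ (factors< N (ℕₚ.<-≤-trans c<d d≤N)))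
                  (Π∣u (suc d) d λ c<d → factors< N (ℕₚ.<-≤-trans c<d d≤N)))

    factors : ∀ d → Factors d
    factors d = factors< (suc d) ℕₚ.≤-refl

    Φ∣q^n-1 : ∀ n → Φ (suc n) ∣ u (suc n)
    Φ∣q^n-1 n = Φ∣u n (factors n)

    comaximal-Φ : ∀ n k → 0 ℕ.< k → k ℕ.< suc n → Comaximal (Φ (suc n)) (u k)
    comaximal-Φ n (suc k) 0<k k<n = comaximal-Φ-u n (λ _ → factors _) (suc k) (ℕ∣.>⇒∤ k<n)

-- The congruence for cyclotomic elements

module CyclotomicLjunggren (R : CommutativeRing 0ℓ 0ℓ) (q : CommutativeRing.Carrier R)
  (Φ : ℕ → CommutativeRing.Carrier R) where

  open CommutativeRing R hiding (zero)
  open import Algebra.Properties.Ring ring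
  open import Algebra.Properties.CommutativeSemiring.Exp commutativeSemiring
  open import Algebra.Properties.CommutativeSemigroup.Divisibility *-commutativeSemigroup
    using (_∣_; _,_)
  open import Relation.Binary.Reasoning.Setoid setoid
  open IntegerSolver R
  open GaussianBinomials R
  open Cyclotomic R q Φ
  open Congruence R using (I; mkI)

  module _ (invertible : ∀ m → ∃ λ r → r * ι (suc m) ≈ 1#)
           (regular : ∀ g {x y} → u (suc g) * x ≈ u (suc g) * y → x ≈ y)
           (exact : ∀ N → (∀ {d} → d ℕ.< N → Π (suc d) d * Φ (suc d) ≈ u (suc d)) →
                    Π (suc N) N ∣ u (suc N) → Π (suc N) N * Φ (suc N) ≈ u (suc N))
           (n′ : ℕ)
    where

    private
      n : ℕ
      n = suc n′
      module L = Ljunggren R (Φ n) q n′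

      ∣⇒I : ∀ {x} → Φ n ∣ x → I (Φ n) 1 x
      ∣⇒I (h , hΦ≈x) = mkI h (trans (sym hΦ≈x) (*-congˡ (sym (*-identityʳ (Φ n)))))

    Φ∣ε : Φ n ∣ L.ε
    Φ∣ε with (h , hΦ≈u) ← Φ∣q^n-1 invertible regular exact n′ = - h , (begin
      - h * Φ n        ≈⟨ -‿distribˡ-* h (Φ n) ⟨
      - (h * Φ n)      ≈⟨ -‿cong hΦ≈u ⟩
      - (q ^ n - 1#)   ≈⟨ solve 1 (λ p → :- (p :- con (+ 1)) := con (+ 1) :- p) refl (q ^ n) ⟩
      1# - q ^ n       ∎)

    inverse : ∀ k → 0 ℕ.< k → k ℕ.< n → ∃ λ v → Φ n ∣ (v * (1# - q ^ k) - 1#)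
    inverse k 0<k k<n with (s , t , e) ← comaximal-Φ invertible regular exact n′ k 0<k k<n = - t , - s , (begin
      - s * Φ n
        ≈⟨ solve 4 (λ s f t p → (:- s) :* f := (:- t) :* (con (+ 1) :- p) :- (s :* f :+ t :* (p :- con (+ 1)))) refl
             s (Φ n) t (q ^ k) ⟩
      - t * (1# - q ^ k) - (s * Φ n + t * u k)
        ≈⟨ +-congˡ (-‿cong e) ⟩
      - t * (1# - q ^ k) - 1# ∎)

    cyclotomic-ljunggren : ∀ a b c → ι 24 * c ≈ ι (quadraticWeight a b) * (ι n * ι n - 1#) →
      ∃ λ h → G q (a ℕ.* n) (b ℕ.* n) - (G (q ^ (n ℕ.* n)) a b - c * (u n * u n)) ≈ h * (Φ n * Φ n * Φ n)
    cyclotomic-ljunggren a b c 24c≈ =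
      let (n⁻¹ , n⁻¹*n≈1) = invertible n′
          (t , t*24≈1) = invertible 23
          mkI h e = L.ljunggren (∣⇒I Φ∣ε) (λ k 0<k k<n → let (v , Φ∣) = inverse k 0<k k<n in v , ∣⇒I Φ∣)
                      {n⁻¹} {t} (trans (*-comm _ _) n⁻¹*n≈1) (trans (*-comm _ _) t*24≈1) a b c 24c≈
      in h , (begin
        G q (a ℕ.* n) (b ℕ.* n) - (G (q ^ (n ℕ.* n)) a b - c * (u n * u n))
          ≈⟨ +-congˡ (-‿cong (+-congˡ (-‿cong (*-congˡ (solve 1 (λ p →
               (p :- con (+ 1)) :* (p :- con (+ 1)) := (con (+ 1) :- p) :* (con (+ 1) :- p)) refl (q ^ n)))))) ⟩
        G q (a ℕ.* n) (b ℕ.* n) - (G (q ^ (n ℕ.* n)) a b - c * (L.ε * L.ε))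
          ≈⟨ e ⟩
        h * (Φ n * (Φ n * (Φ n * 1#)))
          ≈⟨ solve 2 (λ h f → h :* (f :* (f :* (f :* con (+ 1)))) := h :* (f :* f :* f)) refl h (Φ n) ⟩
        h * (Φ n * Φ n * Φ n) ∎)

-- The ring of polynomials over ℚ

open import Defs

module PolyRing where

  infix 4 _≋_
  -- Equality up to trailing zeros. The record keeps both lists visible in the type, where the bare
  -- family of equations would show only their coefficients.
  record _≋_ (p r : Poly) : Set where
    constructor coeffwise
    field
      coeffs : ∀ i → coeff p i ≡ coeff r i
  open _≋_ public

  scale : ℚ → Poly → Poly
  scale c = map (c ℚ.*_)

  ≋-refl : ∀ {p} → p ≋ p
  ≋-refl = coeffwise λ _ → P.refl

  ≋-sym : ∀ {p r} → p ≋ r → r ≋ p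
  ≋-sym e = coeffwise λ i → P.sym (coeffs e i)

  ≋-trans : ∀ {p r s} → p ≋ r → r ≋ s → p ≋ s
  ≋-trans e f = coeffwise λ i → P.trans (coeffs e i) (coeffs f i)

  ≋-isEquivalence : IsEquivalence _≋_
  ≋-isEquivalence = record { refl = ≋-refl ; sym = ≋-sym ; trans = ≋-trans }

  ≋-setoid : Setoid 0ℓ 0ℓ
  ≋-setoid = record { isEquivalence = ≋-isEquivalence }

  open import Relation.Binary.Reasoning.Setoid ≋-setoid

  coeff-⊕ : ∀ p r i → coeff (p ⊕ r) i ≡ coeff p i ℚ.+ coeff r i
  coeff-⊕ [] r i = P.sym (ℚₚ.+-identityˡ _)
  coeff-⊕ (x ∷ p) [] i = P.sym (ℚₚ.+-identityʳ _)
  coeff-⊕ (x ∷ p) (y ∷ r) zero = P.refl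
  coeff-⊕ (x ∷ p) (y ∷ r) (suc i) = coeff-⊕ p r i

  coeff-scale : ∀ c p i → coeff (scale c p) i ≡ c ℚ.* coeff p i
  coeff-scale c [] i = P.sym (ℚₚ.*-zeroʳ c)
  coeff-scale c (x ∷ p) zero = P.refl
  coeff-scale c (x ∷ p) (suc i) = coeff-scale c p i

  coeff-neg : ∀ p i → coeff (neg p) i ≡ ℚ.- coeff p i
  coeff-neg [] i = P.refl
  coeff-neg (x ∷ p) zero = P.refl
  coeff-neg (x ∷ p) (suc i) = coeff-neg p i

  ∷-cong : ∀ {x y p r} → x ≡ y → p ≋ r → x ∷ p ≋ y ∷ r
  ∷-cong x≡y p≋r = coeffwise λ { zero → x≡y ; (suc i) → coeffs p≋r i }

  tail-≋ : ∀ {x y p r} → x ∷ p ≋ y ∷ r → p ≋ r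
  tail-≋ e = coeffwise λ i → coeffs e (suc i)

  0∷-[] : ∀ {p} → p ≋ [] → 0ℚ ∷ p ≋ []
  0∷-[] e = coeffwise λ { zero → P.refl ; (suc i) → coeffs e i }

  ⊕-cong : ∀ {p p′ r r′} → p ≋ p′ → r ≋ r′ → p ⊕ r ≋ p′ ⊕ r′
  ⊕-cong {p} {p′} {r} {r′} e f = coeffwise λ i → P.trans (coeff-⊕ p r i)
    (P.trans (P.cong₂ ℚ._+_ (coeffs e i) (coeffs f i)) (P.sym (coeff-⊕ p′ r′ i)))

  ⊕-assoc : ∀ p r s → (p ⊕ r) ⊕ s ≋ p ⊕ (r ⊕ s)
  ⊕-assoc p r s = coeffwise λ i →
    P.trans (P.trans (coeff-⊕ (p ⊕ r) s i) (P.cong (ℚ._+ coeff s i) (coeff-⊕ p r i)))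
    (P.trans (ℚₚ.+-assoc (coeff p i) (coeff r i) (coeff s i))
    (P.sym (P.trans (coeff-⊕ p (r ⊕ s) i) (P.cong (coeff p i ℚ.+_) (coeff-⊕ r s i)))))

  ⊕-comm : ∀ p r → p ⊕ r ≋ r ⊕ p
  ⊕-comm p r = coeffwise λ i → P.trans (coeff-⊕ p r i)
    (P.trans (ℚₚ.+-comm (coeff p i) (coeff r i)) (P.sym (coeff-⊕ r p i)))

  ⊕-identityʳ : ∀ p → p ⊕ [] ≋ p
  ⊕-identityʳ p = ⊕-comm p []

  neg-cong : ∀ {p r} → p ≋ r → neg p ≋ neg r
  neg-cong {p} {r} e = coeffwise λ i → P.trans (coeff-neg p i)
    (P.trans (P.cong (ℚ.-_) (coeffs e i)) (P.sym (coeff-neg r i)))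

  ⊕-inverseʳ : ∀ p → p ⊕ neg p ≋ []
  ⊕-inverseʳ p = coeffwise λ i → P.trans (coeff-⊕ p (neg p) i)
    (P.trans (P.cong (coeff p i ℚ.+_) (coeff-neg p i)) (ℚₚ.+-inverseʳ (coeff p i)))

  ⊕-isCommutativeSemigroup : Structures.IsCommutativeSemigroup _≋_ _⊕_
  ⊕-isCommutativeSemigroup = record
    { isSemigroup = record
      { isMagma = record { isEquivalence = ≋-isEquivalence ; ∙-cong = ⊕-cong }
      ; assoc = ⊕-assoc
      }
    ; comm = ⊕-comm
    }

  ⊕-commutativeSemigroup : CommutativeSemigroup 0ℓ 0ℓ
  ⊕-commutativeSemigroup = record { isCommutativeSemigroup = ⊕-isCommutativeSemigroup }

  open CommutativeSemigroupProperties ⊕-commutativeSemigroup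
    using () renaming (interchange to ⊕-interchange)

  scale-congʳ : ∀ c {p r} → p ≋ r → scale c p ≋ scale c r
  scale-congʳ c {p} {r} e = coeffwise λ i → P.trans (coeff-scale c p i)
    (P.trans (P.cong (c ℚ.*_) (coeffs e i)) (P.sym (coeff-scale c r i)))

  scale-⊕ : ∀ c p r → scale c (p ⊕ r) ≋ scale c p ⊕ scale c r
  scale-⊕ c p r = coeffwise λ i →
    P.trans (P.trans (coeff-scale c (p ⊕ r) i) (P.cong (c ℚ.*_) (coeff-⊕ p r i)))
    (P.trans (ℚₚ.*-distribˡ-+ c (coeff p i) (coeff r i))
    (P.sym (P.trans (coeff-⊕ (scale c p) (scale c r) i) (P.cong₂ ℚ._+_ (coeff-scale c p i) (coeff-scale c r i)))))

  scale-scale : ∀ c d p → scale (c ℚ.* d) p ≋ scale c (scale d p)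
  scale-scale c d p = coeffwise λ i → P.trans (coeff-scale (c ℚ.* d) p i)
    (P.trans (ℚₚ.*-assoc c d (coeff p i))
    (P.sym (P.trans (coeff-scale c (scale d p) i) (P.cong (c ℚ.*_) (coeff-scale d p i)))))

  scale-0 : ∀ p → scale 0ℚ p ≋ []
  scale-0 p = coeffwise λ i → P.trans (coeff-scale 0ℚ p i) (ℚₚ.*-zeroˡ (coeff p i))

  scale-1 : ∀ p → scale 1ℚ p ≋ p
  scale-1 p = coeffwise λ i → P.trans (coeff-scale 1ℚ p i) (ℚₚ.*-identityˡ (coeff p i))

  scale-0∷ : ∀ c p → scale c (0ℚ ∷ p) ≋ 0ℚ ∷ scale c p
  scale-0∷ c p = ∷-cong (ℚₚ.*-zeroʳ c) ≋-refl

  ∷-const-⊕ : ∀ x p → x ∷ p ≋ const x ⊕ (0ℚ ∷ p)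
  ∷-const-⊕ x p = ∷-cong (P.sym (ℚₚ.+-identityʳ x)) ≋-refl

  ⊛-congˡ : ∀ p {r s} → r ≋ s → p ⊛ r ≋ p ⊛ s
  ⊛-congˡ [] e = ≋-refl
  ⊛-congˡ (x ∷ p) e = ⊕-cong (scale-congʳ x e) (∷-cong P.refl (⊛-congˡ p e))

  ⊛-distribˡ : ∀ p r s → p ⊛ (r ⊕ s) ≋ p ⊛ r ⊕ p ⊛ s
  ⊛-distribˡ [] r s = ≋-refl
  ⊛-distribˡ (x ∷ p) r s = begin
    scale x (r ⊕ s) ⊕ (0ℚ ∷ p ⊛ (r ⊕ s))
      ≈⟨ ⊕-cong (scale-⊕ x r s) (∷-cong P.refl (⊛-distribˡ p r s)) ⟩
    (scale x r ⊕ scale x s) ⊕ ((0ℚ ∷ p ⊛ r) ⊕ (0ℚ ∷ p ⊛ s))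
      ≈⟨ ⊕-interchange (scale x r) (scale x s) (0ℚ ∷ p ⊛ r) (0ℚ ∷ p ⊛ s) ⟩
    (scale x r ⊕ (0ℚ ∷ p ⊛ r)) ⊕ (scale x s ⊕ (0ℚ ∷ p ⊛ s)) ∎

  ⊛-zeroʳ : ∀ p → p ⊛ [] ≋ []
  ⊛-zeroʳ [] = ≋-refl
  ⊛-zeroʳ (x ∷ p) = 0∷-[] (⊛-zeroʳ p)

  ⊛-0∷ : ∀ p r → p ⊛ (0ℚ ∷ r) ≋ 0ℚ ∷ p ⊛ r
  ⊛-0∷ [] r = ≋-sym (0∷-[] ≋-refl)
  ⊛-0∷ (x ∷ p) r = ⊕-cong (scale-0∷ x r) (∷-cong P.refl (⊛-0∷ p r))

  ⊛-const : ∀ p y → p ⊛ const y ≋ scale y p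
  ⊛-const [] y = ≋-refl
  ⊛-const (x ∷ p) y = ∷-cong (P.trans (ℚₚ.+-identityʳ (x ℚ.* y)) (ℚₚ.*-comm x y)) (⊛-const p y)

  ⊛-comm : ∀ p r → p ⊛ r ≋ r ⊛ p
  ⊛-comm [] r = ≋-sym (⊛-zeroʳ r)
  ⊛-comm (x ∷ p) r = begin
    scale x r ⊕ (0ℚ ∷ p ⊛ r)              ≈⟨ ⊕-cong (⊛-const r x) (≋-trans (⊛-0∷ r p) (∷-cong P.refl (⊛-comm r p))) ⟨
    r ⊛ const x ⊕ r ⊛ (0ℚ ∷ p)            ≈⟨ ⊛-distribˡ r (const x) (0ℚ ∷ p) ⟨
    r ⊛ (const x ⊕ (0ℚ ∷ p))              ≈⟨ ⊛-congˡ r (∷-const-⊕ x p) ⟨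
    r ⊛ (x ∷ p)                           ∎

  -- Equal polynomials may be lists of different lengths, so the left factor, on which `_⊛_`
  -- recurses, is exchanged by way of commutativity.
  ⊛-cong : ∀ {p p′ r r′} → p ≋ p′ → r ≋ r′ → p ⊛ r ≋ p′ ⊛ r′
  ⊛-cong {p} {p′} {r} {r′} e f = begin
    p ⊛ r    ≈⟨ ⊛-congˡ p f ⟩
    p ⊛ r′   ≈⟨ ⊛-comm p r′ ⟩
    r′ ⊛ p   ≈⟨ ⊛-congˡ r′ e ⟩
    r′ ⊛ p′  ≈⟨ ⊛-comm r′ p′ ⟩
    p′ ⊛ r′  ∎

  ⊛-distribʳ : ∀ p r s → (r ⊕ s) ⊛ p ≋ r ⊛ p ⊕ s ⊛ p
  ⊛-distribʳ p r s = begin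
    (r ⊕ s) ⊛ p      ≈⟨ ⊛-comm (r ⊕ s) p ⟩
    p ⊛ (r ⊕ s)      ≈⟨ ⊛-distribˡ p r s ⟩
    p ⊛ r ⊕ p ⊛ s    ≈⟨ ⊕-cong (⊛-comm p r) (⊛-comm p s) ⟩
    r ⊛ p ⊕ s ⊛ p    ∎

  0∷-⊛ : ∀ p r → (0ℚ ∷ p) ⊛ r ≋ 0ℚ ∷ p ⊛ r
  0∷-⊛ p r = ⊕-cong (scale-0 r) ≋-refl

  scale-⊛ : ∀ c p r → scale c p ⊛ r ≋ scale c (p ⊛ r)
  scale-⊛ c [] r = ≋-refl
  scale-⊛ c (x ∷ p) r = begin
    scale (c ℚ.* x) r ⊕ (0ℚ ∷ scale c p ⊛ r)
      ≈⟨ ⊕-cong (scale-scale c x r) (≋-trans (∷-cong P.refl (scale-⊛ c p r)) (≋-sym (scale-0∷ c (p ⊛ r)))) ⟩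
    scale c (scale x r) ⊕ scale c (0ℚ ∷ p ⊛ r)
      ≈⟨ scale-⊕ c (scale x r) (0ℚ ∷ p ⊛ r) ⟨
    scale c (scale x r ⊕ (0ℚ ∷ p ⊛ r)) ∎

  ⊛-assoc : ∀ p r s → (p ⊛ r) ⊛ s ≋ p ⊛ (r ⊛ s)
  ⊛-assoc [] r s = ≋-refl
  ⊛-assoc (x ∷ p) r s = begin
    (scale x r ⊕ (0ℚ ∷ p ⊛ r)) ⊛ s
      ≈⟨ ⊛-distribʳ s (scale x r) (0ℚ ∷ p ⊛ r) ⟩
    scale x r ⊛ s ⊕ (0ℚ ∷ p ⊛ r) ⊛ s
      ≈⟨ ⊕-cong (scale-⊛ x r s) (≋-trans (0∷-⊛ (p ⊛ r) s) (∷-cong P.refl (⊛-assoc p r s))) ⟩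
    scale x (r ⊛ s) ⊕ (0ℚ ∷ p ⊛ (r ⊛ s)) ∎

  ⊛-identityˡ : ∀ p → one ⊛ p ≋ p
  ⊛-identityˡ p = begin
    scale 1ℚ p ⊕ (0ℚ ∷ [])   ≈⟨ ⊕-cong (scale-1 p) (0∷-[] ≋-refl) ⟩
    p ⊕ []                   ≈⟨ ⊕-identityʳ p ⟩
    p                        ∎

  ⊛-identityʳ : ∀ p → p ⊛ one ≋ p
  ⊛-identityʳ p = ≋-trans (⊛-comm p one) (⊛-identityˡ p)

  polyRing : CommutativeRing 0ℓ 0ℓ
  polyRing = record
    { Carrier = Poly
    ; _≈_ = _≋_
    ; _+_ = _⊕_
    ; _*_ = _⊛_
    ; -_ = neg
    ; 0# = []
    ; 1# = one
    ; isCommutativeRing = record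
      { isRing = record
        { +-isAbelianGroup = record
          { isGroup = record
            { isMonoid = record
              { isSemigroup = Structures.IsCommutativeSemigroup.isSemigroup ⊕-isCommutativeSemigroup
              ; identity = (λ _ → ≋-refl) , ⊕-identityʳ
              }
            ; inverse = (λ p → ≋-trans (⊕-comm (neg p) p) (⊕-inverseʳ p)) , ⊕-inverseʳ
            ; ⁻¹-cong = neg-cong
            }
          ; comm = ⊕-comm
          }
        ; *-cong = ⊛-cong
        ; *-assoc = ⊛-assoc
        ; *-identity = ⊛-identityˡ , ⊛-identityʳ
        ; distrib = ⊛-distribˡ , ⊛-distribʳ
        }
      ; *-comm = ⊛-comm
      }
    }

open PolyRing

-- Degree bounds, cancellation and exact division

module PolyDivision where

  open import Data.Product using (_×_)
  open IntegerSolver polyRing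
  open CommutativeRing polyRing using (_-_)

  -- Degree less than `n`, insensitive to trailing zeros.
  Below : ℕ → Poly → Set
  Below n p = ∀ i → n ℕ.≤ i → coeff p i ≡ 0ℚ

  coeff-∷-⊛-zero : ∀ x p r → coeff ((x ∷ p) ⊛ r) 0 ≡ x ℚ.* coeff r 0
  coeff-∷-⊛-zero x p r = P.trans (coeff-⊕ (scale x r) (0ℚ ∷ p ⊛ r) 0)
    (P.trans (ℚₚ.+-identityʳ _) (coeff-scale x r 0))

  coeff-∷-⊛-suc : ∀ x p r i → coeff ((x ∷ p) ⊛ r) (suc i) ≡ x ℚ.* coeff r (suc i) ℚ.+ coeff (p ⊛ r) i
  coeff-∷-⊛-suc x p r i = P.trans (coeff-⊕ (scale x r) (0ℚ ∷ p ⊛ r) (suc i))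
    (P.cong (ℚ._+ coeff (p ⊛ r) i) (coeff-scale x r (suc i)))

  coeff-⊛-zero : ∀ p r → coeff (p ⊛ r) 0 ≡ coeff p 0 ℚ.* coeff r 0
  coeff-⊛-zero [] r = P.sym (ℚₚ.*-zeroˡ (coeff r 0))
  coeff-⊛-zero (x ∷ p) r = coeff-∷-⊛-zero x p r

  coeff-⊛-top : ∀ d e p r → Below (suc d) p → Below (suc e) r →
    coeff (p ⊛ r) (d ℕ.+ e) ≡ coeff p d ℚ.* coeff r e
  coeff-⊛-top d e [] r _ _ = P.sym (ℚₚ.*-zeroˡ (coeff r e))
  coeff-⊛-top zero e (x ∷ p) r p< r< = P.trans (coeffs (⊕-cong (≋-refl {scale x r}) (0∷-[] p⊛r≋[])) e)
    (P.trans (coeffs (⊕-identityʳ (scale x r)) e) (coeff-scale x r e))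
    where
    p⊛r≋[] : p ⊛ r ≋ []
    p⊛r≋[] = ⊛-cong {p} {[]} {r} {r} (coeffwise λ i → p< (suc i) (s≤s z≤n)) ≋-refl
  coeff-⊛-top (suc d) e (x ∷ p) r p< r< =
    P.trans (coeff-∷-⊛-suc x p r (d ℕ.+ e))
    (P.trans (P.cong₂ ℚ._+_ (P.trans (P.cong (x ℚ.*_) (r< (suc (d ℕ.+ e)) (s≤s (ℕₚ.m≤n+m e d)))) (ℚₚ.*-zeroʳ x))
                            (coeff-⊛-top d e p r (λ i d<i → p< (suc i) (s≤s d<i)) r<))
             (ℚₚ.+-identityˡ _))

  top : ∀ p → p ≋ [] ⊎ ∃ λ d → coeff p d ≢ 0ℚ × Below (suc d) p
  top [] = inj₁ ≋-refl
  top (x ∷ p) with top p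
  ... | inj₂ (d , nz , p<) = inj₂ (suc d , nz , λ { (suc i) (s≤s d<i) → p< i d<i })
  ... | inj₁ p≋[] with x ℚₚ.≟ 0ℚ
  ...   | yes P.refl = inj₁ (0∷-[] p≋[])
  ...   | no x≢0 = inj₂ (0 , x≢0 , λ { (suc i) _ → coeffs p≋[] i })

  x*y≡0⇒y≡0 : ∀ x y → x ≢ 0ℚ → x ℚ.* y ≡ 0ℚ → y ≡ 0ℚ
  x*y≡0⇒y≡0 x y x≢0 xy≡0 = begin
    y                    ≡⟨ ℚₚ.*-identityˡ y ⟨
    1ℚ ℚ.* y             ≡⟨ P.cong (ℚ._* y) (ℚₚ.*-inverseˡ x) ⟨
    ℚ.1/ x ℚ.* x ℚ.* y   ≡⟨ ℚₚ.*-assoc (ℚ.1/ x) x y ⟩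
    ℚ.1/ x ℚ.* (x ℚ.* y) ≡⟨ P.cong (ℚ.1/ x ℚ.*_) xy≡0 ⟩
    ℚ.1/ x ℚ.* 0ℚ        ≡⟨ ℚₚ.*-zeroʳ (ℚ.1/ x) ⟩
    0ℚ                   ∎
    where
    open P.≡-Reasoning
    instance _ = ℚ.≢-nonZero x≢0

  Below-length : ∀ p → Below (lengthP p) p
  Below-length [] i _ = P.refl
  Below-length (x ∷ p) (suc i) (s≤s p≤i) = Below-length p i p≤i

  -- While the bound on `r` exceeds n, the top coefficient of `r` times the leading one of `p` is a
  -- coefficient of the product that must vanish. This shows that the fuel of `divExact` covers the
  -- whole quotient.
  Below-⊛-cancel : ∀ n p r → ¬ p ≋ [] → Below n (p ⊛ r) → Below n r
  Below-⊛-cancel n p r p≢[] pr< with top p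
  ... | inj₁ p≋[] = contradiction p≋[] p≢[]
  ... | inj₂ (d , nz , p<) = go (lengthP r) (Below-length r)
    where
    go : ∀ m → Below m r → Below n r
    go m r< with m ℕ.≤? n
    ... | yes m≤n = λ i n≤i → r< i (ℕₚ.≤-trans m≤n n≤i)
    go zero r< | no m≰n = contradiction z≤n m≰n
    go (suc m) r< | no m≰n = go m below
      where
      below : Below m r
      below i m≤i with i ℕₚ.≟ m
      ... | no i≢m = r< i (ℕₚ.≤∧≢⇒< m≤i (λ m≡i → i≢m (P.sym m≡i)))
      ... | yes P.refl = x*y≡0⇒y≡0 (coeff p d) (coeff r i) nz
        (P.trans (P.sym (coeff-⊛-top d i p r p< r<))
                 (pr< (d ℕ.+ i) (ℕₚ.≤-trans (ℕₚ.≤-pred (ℕₚ.≰⇒> m≰n)) (ℕₚ.m≤n+m i d))))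

  -- The constant term of the product forces that of `r` to be 0, after which a factor q can be
  -- removed from `r`.
  ⊛-nonzeroDivisor : ∀ p r → coeff p 0 ≢ 0ℚ → p ⊛ r ≋ [] → r ≋ []
  ⊛-nonzeroDivisor p [] p₀≢0 pr≋[] = ≋-refl
  ⊛-nonzeroDivisor p (x ∷ r) p₀≢0 pr≋[]
    with x*y≡0⇒y≡0 (coeff p 0) x p₀≢0 (P.trans (P.sym (coeff-⊛-zero p (x ∷ r))) (coeffs pr≋[] 0))
  ... | P.refl = 0∷-[] (⊛-nonzeroDivisor p r p₀≢0
    (tail-≋ (≋-trans (≋-sym (⊛-0∷ p r)) (≋-trans pr≋[] (≋-sym (0∷-[] ≋-refl))))))

  ⊛-cancelˡ : ∀ p {r s} → coeff p 0 ≢ 0ℚ → p ⊛ r ≋ p ⊛ s → r ≋ s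
  ⊛-cancelˡ p {r} {s} p₀≢0 e = begin
    r            ≈⟨ solve 2 (λ r s → r := (r :- s) :+ s) ≋-refl r s ⟩
    (r - s) ⊕ s  ≈⟨ ⊕-cong (⊛-nonzeroDivisor p (r - s) p₀≢0 (begin
      p ⊛ (r - s)      ≈⟨ solve 3 (λ p r s → p :* (r :- s) := p :* r :- p :* s) ≋-refl p r s ⟩
      p ⊛ r - p ⊛ s    ≈⟨ ⊕-cong e ≋-refl ⟩
      p ⊛ s - p ⊛ s    ≈⟨ ⊕-inverseʳ (p ⊛ s) ⟩
      []               ∎)) ≋-refl ⟩
    s ∎
    where open import Relation.Binary.Reasoning.Setoid ≋-setoid

  -- Constant term ±1, in the form that `divF` relies on when it multiplies by this term instead of
  -- dividing by it.
  UnitConstant : Poly → Set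
  UnitConstant p = coeff p 0 ℚ.* coeff p 0 ≡ 1ℚ

  UnitConstant⇒≢0 : ∀ p → UnitConstant p → coeff p 0 ≢ 0ℚ
  UnitConstant⇒≢0 p unit p₀≡0
    with () ← P.trans (P.sym (P.trans (P.cong (ℚ._* coeff p 0) p₀≡0) (ℚₚ.*-zeroˡ (coeff p 0)))) unit

  head0-coeff : ∀ p → head0 p ≡ coeff p 0
  head0-coeff [] = P.refl
  head0-coeff (x ∷ p) = P.refl

  coeff-tail0 : ∀ p i → coeff (tail0 p) i ≡ coeff p (suc i)
  coeff-tail0 [] i = P.refl
  coeff-tail0 (x ∷ p) i = P.refl

  tail0-cong : ∀ {p r} → p ≋ r → tail0 p ≋ tail0 r
  tail0-cong {p} {r} e = coeffwise λ i → P.trans (coeff-tail0 p i) (P.trans (coeffs e (suc i)) (P.sym (coeff-tail0 r i)))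

  ∷-head-tail : ∀ p → p ≋ coeff p 0 ∷ tail0 p
  ∷-head-tail [] = ≋-sym (0∷-[] ≋-refl)
  ∷-head-tail (x ∷ p) = ≋-refl

  -- After one elimination the remainder is q times b times the tail of `c`, so that the recursive
  -- call faces the same problem for that tail.
  divF-coeff : ∀ f a b c → UnitConstant b → b ⊛ c ≋ a → ∀ i → i ℕ.< f → coeff (divF f a b) i ≡ coeff c i
  divF-coeff (suc f) a b c unit bc≋a = λ { zero _ → head≡ ; (suc i) (s≤s i<f) → P.trans (ih i i<f) (coeff-tail0 c i) }
    where
    open P.≡-Reasoning
    h : ℚ
    h = head0 a ℚ.* head0 b
    head≡ : h ≡ coeff c 0
    head≡ = begin
      head0 a ℚ.* head0 b                           ≡⟨ P.cong₂ ℚ._*_ (head0-coeff a) (head0-coeff b) ⟩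
      coeff a 0 ℚ.* coeff b 0                       ≡⟨ P.cong (ℚ._* coeff b 0) (P.sym (coeffs bc≋a 0)) ⟩
      coeff (b ⊛ c) 0 ℚ.* coeff b 0                 ≡⟨ P.cong (ℚ._* coeff b 0) (coeff-⊛-zero b c) ⟩
      coeff b 0 ℚ.* coeff c 0 ℚ.* coeff b 0         ≡⟨ ℚₚ.*-comm _ (coeff b 0) ⟩
      coeff b 0 ℚ.* (coeff b 0 ℚ.* coeff c 0)       ≡⟨ ℚₚ.*-assoc (coeff b 0) (coeff b 0) (coeff c 0) ⟨
      coeff b 0 ℚ.* coeff b 0 ℚ.* coeff c 0         ≡⟨ P.cong (ℚ._* coeff c 0) unit ⟩
      1ℚ ℚ.* coeff c 0                              ≡⟨ ℚₚ.*-identityˡ (coeff c 0) ⟩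
      coeff c 0                                     ∎
    remainder : a ⊖ scale h b ≋ 0ℚ ∷ b ⊛ tail0 c
    remainder = R.begin
      a ⊖ scale h b
        R.≈⟨ ⊕-cong (≋-trans (≋-sym bc≋a) (⊛-congˡ b (≋-trans (∷-head-tail c) (∷-const-⊕ (coeff c 0) (tail0 c)))))
                    (neg-cong (≋-sym (⊛-const b h))) ⟩
      b ⊛ (const (coeff c 0) ⊕ (0ℚ ∷ tail0 c)) ⊖ b ⊛ const h
        R.≡⟨ P.cong (λ x → b ⊛ (const (coeff c 0) ⊕ (0ℚ ∷ tail0 c)) ⊖ b ⊛ const x) head≡ ⟩
      b ⊛ (const (coeff c 0) ⊕ (0ℚ ∷ tail0 c)) ⊖ b ⊛ const (coeff c 0)
        R.≈⟨ solve 3 (λ b x y → b :* (x :+ y) :- b :* x := b :* y) ≋-refl b (const (coeff c 0)) (0ℚ ∷ tail0 c) ⟩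
      b ⊛ (0ℚ ∷ tail0 c)
        R.≈⟨ ⊛-0∷ b (tail0 c) ⟩
      0ℚ ∷ b ⊛ tail0 c R.∎
      where import Relation.Binary.Reasoning.Setoid ≋-setoid as R
    ih : ∀ i → i ℕ.< f → coeff (divF f (tail0 (a ⊖ scale h b)) b) i ≡ coeff (tail0 c) i
    ih = divF-coeff f _ b (tail0 c) unit (≋-sym (tail0-cong remainder))

  divF-Below : ∀ f a b → Below f (divF f a b)
  divF-Below zero a b i _ = P.refl
  divF-Below (suc f) a b (suc i) (s≤s f≤i) = divF-Below f _ b i f≤i

  -- Up to the fuel the coefficients agree by `divF-coeff`. Beyond it both sides are zero, since the
  -- degree of `c` is bounded by the length of `a`.
  divExact-unique : ∀ a b c → UnitConstant b → b ⊛ c ≋ a → divExact a b ≋ c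
  divExact-unique a b c unit bc≋a = coeffwise go
    where
    c< : Below (lengthP a) c
    c< = Below-⊛-cancel (lengthP a) b c (λ b≋[] → UnitConstant⇒≢0 b unit (coeffs b≋[] 0))
      (λ i a≤i → P.trans (coeffs bc≋a i) (Below-length a i a≤i))
    go : ∀ i → coeff (divExact a b) i ≡ coeff c i
    go i with i ℕ.<? lengthP a
    ... | yes i<a = divF-coeff (lengthP a) a b c unit bc≋a i i<a
    ... | no i≮a = P.trans (divF-Below (lengthP a) a b i (ℕₚ.≮⇒≥ i≮a)) (P.sym (c< i (ℕₚ.≮⇒≥ i≮a)))

open PolyDivision

-- The q-binomials of the statement as values of `G`

open import Data.Nat using (_≤_; _*_)
open import Data.Integer using (_-_)
open import Data.Rational using (_/_)
open IntegerSolver polyRing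
open GaussianBinomials polyRing
open CommutativeRing polyRing using (reflexive) renaming (_-_ to _∖_)
open import Algebra.Properties.CommutativeSemiring.Exp (CommutativeRing.commutativeSemiring polyRing)
  using () renaming (_^_ to _^^_)
open import Algebra.Properties.CommutativeSemigroup.Divisibility (CommutativeRing.*-commutativeSemigroup polyRing)
  using (_∣_; _,_)
open CommutativeSemigroupProperties (CommutativeRing.*-commutativeSemigroup ℚₚ.+-*-commutativeRing)
  using () renaming (interchange to ℚ-interchange)
open import Relation.Binary.Reasoning.Setoid ≋-setoid

X : Poly
X = 0ℚ ∷ one

X-⊛ : ∀ p → X ⊛ p ≋ 0ℚ ∷ p
X-⊛ p = ≋-trans (0∷-⊛ one p) (∷-cong P.refl (⊛-identityˡ p))

X^≋ : ∀ k → X^ k ≋ X ^^ k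
X^≋ zero = ≋-refl
X^≋ (suc k) = ≋-trans (∷-cong P.refl (X^≋ k)) (≋-sym (X-⊛ (X ^^ k)))

qint≋ : ∀ n → qint n ≋ ∑ n (X ^^_)
qint≋ zero = ≋-refl
qint≋ (suc n) = begin
  1ℚ ∷ qint n                         ≈⟨ ∷-const-⊕ 1ℚ (qint n) ⟩
  one ⊕ (0ℚ ∷ qint n)                 ≈⟨ ⊕-cong (≋-refl {one}) (≋-trans (≋-sym (X-⊛ (qint n))) (⊛-congˡ X (qint≋ n))) ⟩
  one ⊕ X ⊛ ∑ n (X ^^_)               ≈⟨ ⊕-cong (≋-refl {one}) (*-distribˡ-∑ n X (X ^^_)) ⟩
  one ⊕ ∑ n (λ i → X ^^ suc i)        ≈⟨ ∑-head n (X ^^_) ⟨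
  ∑ (suc n) (X ^^_)                   ∎

UnitConstant-resp : ∀ {p r} → p ≋ r → UnitConstant p → UnitConstant r
UnitConstant-resp e = P.trans (P.sym (P.cong₂ ℚ._*_ (coeffs e 0) (coeffs e 0)))

square-⊛ : ∀ p r → coeff (p ⊛ r) 0 ℚ.* coeff (p ⊛ r) 0 ≡ coeff p 0 ℚ.* coeff p 0 ℚ.* (coeff r 0 ℚ.* coeff r 0)
square-⊛ p r = P.trans (P.cong₂ ℚ._*_ (coeff-⊛-zero p r) (coeff-⊛-zero p r))
  (ℚ-interchange (coeff p 0) (coeff r 0) (coeff p 0) (coeff r 0))

UnitConstant-⊛ : ∀ p r → UnitConstant p → UnitConstant r → UnitConstant (p ⊛ r)
UnitConstant-⊛ p r up ur = P.trans (square-⊛ p r) (P.cong₂ ℚ._*_ up ur)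

UnitConstant-factor : ∀ p r → UnitConstant p → UnitConstant (p ⊛ r) → UnitConstant r
UnitConstant-factor p r up upr = P.trans (P.sym (ℚₚ.*-identityˡ _))
  (P.trans (P.cong (ℚ._* (coeff r 0 ℚ.* coeff r 0)) (P.sym up)) (P.trans (P.sym (square-⊛ p r)) upr))

UnitConstant-qfact : ∀ n → UnitConstant (qfact n)
UnitConstant-qfact zero = P.refl
UnitConstant-qfact (suc n) = UnitConstant-⊛ (qint (suc n)) (qfact n) P.refl (UnitConstant-qfact n)

-- The factorial formula exhibits `G X n k` as a true quotient, and uniqueness of exact division
-- identifies it with the computed one.
qbinom≋G : ∀ n k → qbinom n k ≋ G X n k
qbinom≋G n k with k ℕ.≤? n
... | no k≰n = ≋-trans (reflexive (P.cong (λ b → if b then quotient else []) (dec-false (k ℕ.≤? n) k≰n)))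
                       (≋-sym (n<k⇒G≈0 X (ℕₚ.≰⇒> k≰n)))
  where
  quotient : Poly
  quotient = divExact (qfact n) (qfact k ⊛ qfact (n ∸ k))
... | yes k≤n = ≋-trans (reflexive (P.cong (λ b → if b then quotient else []) (dec-true (k ℕ.≤? n) k≤n)))
  (divExact-unique (qfact n) (qfact k ⊛ qfact (n ∸ k)) (G X n k)
    (UnitConstant-⊛ (qfact k) (qfact (n ∸ k)) (UnitConstant-qfact k) (UnitConstant-qfact (n ∸ k)))
    (≋-trans (⊛-comm _ (G X n k))
      (P.subst (λ m → G X m k ⊛ (qfact k ⊛ qfact (n ∸ k)) ≋ qfact m) (ℕₚ.m+[n∸m]≡n k≤n)
        (G-factorial X qfact ≋-refl (λ m → ⊛-cong (qint≋ (suc m)) ≋-refl) k (n ∸ k)))))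
  where
  quotient : Poly
  quotient = divExact (qfact n) (qfact k ⊛ qfact (n ∸ k))

const-0 : const 0ℚ ≋ []
const-0 = 0∷-[] ≋-refl

const-⊛-const : ∀ x y → const x ⊛ const y ≋ const (x ℚ.* y)
const-⊛-const x y = ∷-cong (ℚₚ.+-identityʳ (x ℚ.* y)) ≋-refl

-- Substitution into q-binomials

module _ (r : Poly) where

  -- A list of zeros also represents the zero polynomial; this lets `compose` respect `≋` between
  -- lists of different lengths.
  compose-[] : ∀ {p} → p ≋ [] → compose p r ≋ []
  compose-[] {[]} e = ≋-refl
  compose-[] {x ∷ p} e = begin
    const x ⊕ r ⊛ compose p r
      ≈⟨ ⊕-cong (∷-cong (coeffs e 0) ≋-refl) (⊛-congˡ r (compose-[] {p} (coeffwise λ i → coeffs e (suc i)))) ⟩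
    const 0ℚ ⊕ r ⊛ []
      ≈⟨ ⊕-cong const-0 (⊛-zeroʳ r) ⟩
    [] ∎

  compose-cong : ∀ {p s} → p ≋ s → compose p r ≋ compose s r
  compose-cong {[]} {s} e = ≋-sym (compose-[] (≋-sym e))
  compose-cong {x ∷ p} {[]} e = compose-[] e
  compose-cong {x ∷ p} {y ∷ s} e = ⊕-cong (∷-cong (coeffs e 0) ≋-refl) (⊛-congˡ r (compose-cong (tail-≋ e)))

  compose-⊕ : ∀ p s → compose (p ⊕ s) r ≋ compose p r ⊕ compose s r
  compose-⊕ [] s = ≋-refl
  compose-⊕ (x ∷ p) [] = ≋-sym (⊕-identityʳ _)
  compose-⊕ (x ∷ p) (y ∷ s) = begin
    const x ⊕ const y ⊕ r ⊛ compose (p ⊕ s) r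
      ≈⟨ ⊕-cong (≋-refl {const x ⊕ const y}) (⊛-congˡ r (compose-⊕ p s)) ⟩
    const x ⊕ const y ⊕ r ⊛ (compose p r ⊕ compose s r)
      ≈⟨ solve 5 (λ x y r p s → x :+ y :+ r :* (p :+ s) := (x :+ r :* p) :+ (y :+ r :* s)) ≋-refl
           (const x) (const y) r (compose p r) (compose s r) ⟩
    (const x ⊕ r ⊛ compose p r) ⊕ (const y ⊕ r ⊛ compose s r) ∎

  -- Pascal's rule multiplies by powers of `X` alone, so that this and `compose-⊕` carry the
  -- recursion of `compose-G`.
  compose-X^ : ∀ k p → compose (X ^^ k ⊛ p) r ≋ r ^^ k ⊛ compose p r
  compose-X^ zero p = ≋-trans (compose-cong (⊛-identityˡ p)) (≋-sym (⊛-identityˡ _))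
  compose-X^ (suc k) p = begin
    compose (X ⊛ X ^^ k ⊛ p) r               ≈⟨ compose-cong (≋-trans (⊛-assoc X (X ^^ k) p) (X-⊛ _)) ⟩
    const 0ℚ ⊕ r ⊛ compose (X ^^ k ⊛ p) r    ≈⟨ ⊕-cong const-0 (⊛-congˡ r (compose-X^ k p)) ⟩
    r ⊛ (r ^^ k ⊛ compose p r)               ≈⟨ ⊛-assoc r (r ^^ k) _ ⟨
    r ⊛ r ^^ k ⊛ compose p r                 ∎

  compose-G : ∀ n k → compose (G X n k) r ≋ G r n k
  compose-G n zero = ≋-trans (⊕-cong (≋-refl {one}) (⊛-zeroʳ r)) (⊕-identityʳ one)
  compose-G zero (suc k) = ≋-refl
  compose-G (suc n) (suc k) = begin
    compose (G X n k ⊕ X ^^ suc k ⊛ G X n (suc k)) r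
      ≈⟨ compose-⊕ (G X n k) _ ⟩
    compose (G X n k) r ⊕ compose (X ^^ suc k ⊛ G X n (suc k)) r
      ≈⟨ ⊕-cong (compose-G n k) (≋-trans (compose-X^ (suc k) (G X n (suc k))) (⊛-congˡ (r ^^ suc k) (compose-G n (suc k)))) ⟩
    G r n k ⊕ r ^^ suc k ⊛ G r n (suc k) ∎

-- Rational constants

toℚᵘ-/ : ∀ i d → ℚ.toℚᵘ (i / suc d) ℚᵘ.≃ mkℚᵘ i d
toℚᵘ-/ i d = ℚₚ.toℚᵘ-fromℚᵘ (mkℚᵘ i d)

-- `_/_` reduces fractions by a gcd that is opaque for variables. For unnormalised fractions the
-- identity is a cross multiplication; `*-/` takes the same route.
suc/1 : ∀ n → + suc n / 1 ≡ 1ℚ ℚ.+ + n / 1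
suc/1 n = ℚₚ.toℚᵘ-injective (ℚᵘₚ.≃-trans (toℚᵘ-/ (+ suc n) 0)
  (ℚᵘₚ.≃-trans (*≡* (P.cong (ℤ._* + 1) (P.cong (λ m → + 1 ℤ.+ m) (P.sym (ℤₚ.*-identityʳ (+ n))))))
    (ℚᵘₚ.≃-sym (ℚᵘₚ.≃-trans (ℚₚ.toℚᵘ-homo-+ 1ℚ (+ n / 1)) (ℚᵘₚ.+-congʳ (ℚ.toℚᵘ 1ℚ) (toℚᵘ-/ (+ n) 0))))))

*-/ : ∀ d z → (+ suc d / 1) ℚ.* (z / suc d) ≡ z / 1
*-/ d z = ℚₚ.toℚᵘ-injective (ℚᵘₚ.≃-trans (ℚₚ.toℚᵘ-homo-* (+ suc d / 1) (z / suc d))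
  (ℚᵘₚ.≃-trans (ℚᵘₚ.*-cong (toℚᵘ-/ (+ suc d) 0) (toℚᵘ-/ z d))
    (ℚᵘₚ.≃-trans (*≡* eq) (ℚᵘₚ.≃-sym (toℚᵘ-/ z 0)))))
  where
  eq : + suc d ℤ.* z ℤ.* + 1 ≡ z ℤ.* + suc (d ℕ.+ 0)
  eq = P.trans (ℤₚ.*-identityʳ (+ suc d ℤ.* z)) (P.trans (ℤₚ.*-comm (+ suc d) z)
         (P.cong (λ e → z ℤ.* + suc e) (P.sym (ℕₚ.+-identityʳ d))))

ι≋const : ∀ n → ι n ≋ const (+ n / 1)
ι≋const zero = ≋-sym const-0
ι≋const (suc n) = begin
  ι (suc n)               ≈⟨ ι-suc n ⟩
  one ⊕ ι n               ≈⟨ ⊕-cong (≋-refl {one}) (ι≋const n) ⟩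
  const (1ℚ ℚ.+ + n / 1)  ≈⟨ ∷-cong (suc/1 n) ≋-refl ⟨
  const (+ suc n / 1)     ∎

ι-⊛-const : ∀ d z → ι (suc d) ⊛ const (z / suc d) ≋ const (z / 1)
ι-⊛-const d z = begin
  ι (suc d) ⊛ const (z / suc d)              ≈⟨ ⊛-cong (ι≋const (suc d)) (≋-refl {const (z / suc d)}) ⟩
  const (+ suc d / 1) ⊛ const (z / suc d)    ≈⟨ const-⊛-const (+ suc d / 1) (z / suc d) ⟩
  const ((+ suc d / 1) ℚ.* (z / suc d))      ≈⟨ ∷-cong (*-/ d z) ≋-refl ⟩
  const (z / 1)                              ∎

ι-inverse : ∀ d → ι (suc d) ⊛ const (+ 1 / suc d) ≋ one
ι-inverse d = ι-⊛-const d (+ 1)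

-- Exactness of the divisions that define Φ

length-cycTable : ∀ n → length (cycTable n) ≡ n
length-cycTable zero = P.refl
length-cycTable (suc n) = P.trans (Listₚ.length-++ (cycTable n))
  (P.trans (ℕₚ.+-comm (length (cycTable n)) 1) (P.cong suc (length-cycTable n)))

nth-++ˡ : ∀ ps rs i → i ℕ.< length ps → nth (ps ++ rs) i ≡ nth ps i
nth-++ˡ (p ∷ ps) rs zero i< = P.refl
nth-++ˡ (p ∷ ps) rs (suc i) (s≤s i<) = nth-++ˡ ps rs i i<

nth-++-length : ∀ ps r → nth (ps ++ r ∷ []) (length ps) ≡ r
nth-++-length [] r = P.refl
nth-++-length (p ∷ ps) r = nth-++-length ps r

-- Tables grow only at their end, so that an entry never changes once it is present.
nth-cycTable : ∀ n i → i ℕ.< n → nth (cycTable n) i ≡ Φ (suc i)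
nth-cycTable (suc n) i i<1+n with i ℕₚ.≟ n
... | yes P.refl = P.refl
... | no i≢n = P.trans (nth-++ˡ (cycTable n) _ i (P.subst (i ℕ.<_) (P.sym (length-cycTable n)) i<n))
  (nth-cycTable n i i<n)
  where
  i<n : i ℕ.< n
  i<n = ℕₚ.≤∧≢⇒< (ℕₚ.≤-pred i<1+n) i≢n

-- The bound `m` on the divisors is detached from the table size `n` for an induction on `m`; the
-- definition of Φ has m = n.
properFactors : ℕ → ℕ → List Poly
properFactors n m = map (λ d → nth (cycTable n) (d ∸ 1)) (filter (ℕ∣._∣? suc n) (map suc (upTo m)))

Φ-suc : ∀ n → Φ (suc n) ≡ divExact (X^ (suc n) ⊖ one) (prodP (properFactors n n))
Φ-suc n = P.subst (λ i → nth (cycTable (suc n)) i ≡ divExact (X^ (suc n) ⊖ one) (prodP (properFactors n n)))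
  (length-cycTable n) (nth-++-length (cycTable n) _)

prodP-++ : ∀ ps rs → prodP (ps ++ rs) ≋ prodP ps ⊛ prodP rs
prodP-++ [] rs = ≋-sym (⊛-identityˡ _)
prodP-++ (p ∷ ps) rs = ≋-trans (⊛-congˡ p (prodP-++ ps rs)) (≋-sym (⊛-assoc p _ _))

open Cyclotomic polyRing X Φ
open CyclotomicLjunggren polyRing X Φ

prodP-filter-single : ∀ {P : Pred ℕ 0ℓ} (P? : Decidable P) f d →
  prodP (map f (filter P? (d ∷ []))) ≋ choose (P? d) (f d)
prodP-filter-single P? f d with does (P? d)
... | true = ⊛-identityʳ (f d)
... | false = ≋-refl

-- The last candidate divisor is split off, because `Π` grows at that end while the list is built
-- from the front.
prodP-properFactors : ∀ n m → m ≤ n → prodP (properFactors n m) ≋ Π (suc n) m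
prodP-properFactors n zero m≤n = ≋-refl
prodP-properFactors n (suc m) m<n = begin
  prodP (map f (filter P? (map suc (upTo (suc m)))))
    ≡⟨ P.cong (λ ds → prodP (map f (filter P? (map suc ds)))) (Listₚ.applyUpTo-∷ʳ (λ i → i) m) ⟨
  prodP (map f (filter P? (map suc (upTo m ++ m ∷ []))))
    ≡⟨ P.cong (λ ds → prodP (map f (filter P? ds))) (Listₚ.map-++ suc (upTo m) (m ∷ [])) ⟩
  prodP (map f (filter P? (map suc (upTo m) ++ suc m ∷ [])))
    ≡⟨ P.cong (λ ds → prodP (map f ds)) (Listₚ.filter-++ P? (map suc (upTo m)) (suc m ∷ [])) ⟩
  prodP (map f (filter P? (map suc (upTo m)) ++ filter P? (suc m ∷ [])))
    ≡⟨ P.cong prodP (Listₚ.map-++ f (filter P? (map suc (upTo m))) _) ⟩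
  prodP (properFactors n m ++ map f (filter P? (suc m ∷ [])))
    ≈⟨ prodP-++ (properFactors n m) _ ⟩
  prodP (properFactors n m) ⊛ prodP (map f (filter P? (suc m ∷ [])))
    ≈⟨ ⊛-cong (prodP-properFactors n m (ℕₚ.<⇒≤ m<n)) (prodP-filter-single P? f (suc m)) ⟩
  Π (suc n) m ⊛ choose (P? (suc m)) (f (suc m))
    ≡⟨ P.cong (λ φ → Π (suc n) m ⊛ choose (P? (suc m)) φ) (nth-cycTable n m m<n) ⟩
  Π (suc n) (suc m) ∎
  where
  f : ℕ → Poly
  f d = nth (cycTable n) (d ∸ 1)
  P? : Decidable (ℕ∣._∣ suc n)
  P? = ℕ∣._∣? suc n

coeff-u : ∀ d → coeff (u (suc d)) 0 ≡ ℚ.- 1ℚ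
coeff-u d = P.trans (coeff-⊕ (X ⊛ X ^^ d) (neg one) 0) (P.cong (ℚ._+ ℚ.- 1ℚ) (coeffs (X-⊛ (X ^^ d)) 0))

UnitConstant-u : ∀ d → UnitConstant (u (suc d))
UnitConstant-u d = P.cong₂ ℚ._*_ (coeff-u d) (coeff-u d)

UnitConstant-Π : ∀ n m → (∀ {d} → d ℕ.< m → UnitConstant (Φ (suc d))) → UnitConstant (Π n m)
UnitConstant-Π n zero unit = P.refl
UnitConstant-Π n (suc m) unit = UnitConstant-⊛ (Π n m) (factor n (suc m))
  (UnitConstant-Π n m (λ d<m → unit (ℕₚ.m<n⇒m<1+n d<m))) (go (suc m ℕ∣.∣? n))
  where
  go : ∀ {A : Set} (d : Dec A) → UnitConstant (choose d (Φ (suc m)))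
  go (yes _) = unit ℕₚ.≤-refl
  go (no _) = P.refl

-- In `Π * Φ` = q^(d + 1) - 1 the right side has constant term -1 and the product of smaller factors
-- has ±1 by induction, which leaves ±1 for Φ.
UnitConstant-Φ : ∀ n → (∀ {d} → d ℕ.< n → Π (suc d) d ⊛ Φ (suc d) ≋ u (suc d)) →
  ∀ {d} → d ℕ.< n → UnitConstant (Φ (suc d))
UnitConstant-Φ (suc n) factors {d} d<1+n = UnitConstant-factor (Π (suc d) d) (Φ (suc d))
  (UnitConstant-Π (suc d) d (λ c<d → UnitConstant-Φ n (λ c<n → factors (ℕₚ.m<n⇒m<1+n c<n))
    (ℕₚ.<-≤-trans c<d (ℕₚ.≤-pred d<1+n))))
  (UnitConstant-resp (≋-sym (factors d<1+n)) (UnitConstant-u d))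

-- This meets the hypothesis `exact`: the smaller factorisations give the divisor a constant term
-- ±1, and then `divExact` returns the given cofactor `h`.
Φ-exact : ∀ n → (∀ {d} → d ℕ.< n → Π (suc d) d ⊛ Φ (suc d) ≋ u (suc d)) →
  Π (suc n) n ∣ u (suc n) → Π (suc n) n ⊛ Φ (suc n) ≋ u (suc n)
Φ-exact n factors (h , hΠ≈u) = ≋-trans (⊛-congˡ (Π (suc n) n) Φ≋h) (≋-trans (⊛-comm _ h) hΠ≈u)
  where
  B≋Π : prodP (properFactors n n) ≋ Π (suc n) n
  B≋Π = prodP-properFactors n n ℕₚ.≤-refl
  Φ≋h : Φ (suc n) ≋ h
  Φ≋h = P.subst (_≋ h) (P.sym (Φ-suc n)) (divExact-unique (X^ (suc n) ⊖ one) (prodP (properFactors n n)) h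
    (UnitConstant-resp (≋-sym B≋Π) (UnitConstant-Π (suc n) n (UnitConstant-Φ n factors)))
    (begin
      prodP (properFactors n n) ⊛ h   ≈⟨ ⊛-cong B≋Π (≋-refl {h}) ⟩
      Π (suc n) n ⊛ h                 ≈⟨ ⊛-comm _ h ⟩
      h ⊛ Π (suc n) n                 ≈⟨ hΠ≈u ⟩
      u (suc n)                       ≈⟨ ⊕-cong (X^≋ (suc n)) (≋-refl {neg one}) ⟨
      X^ (suc n) ⊖ one                ∎))

ι-invertible : ∀ m → ∃ λ r → r ⊛ ι (suc m) ≋ one
ι-invertible m = const (+ 1 / suc m) , ≋-trans (⊛-comm (const (+ 1 / suc m)) (ι (suc m))) (ι-inverse m)

u-regular : ∀ g {p r} → u (suc g) ⊛ p ≋ u (suc g) ⊛ r → p ≋ r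
u-regular g = ⊛-cancelˡ (u (suc g)) (UnitConstant⇒≢0 (u (suc g)) (UnitConstant-u g))

-- The rational coefficient and the final congruence

module _ (n′ : ℕ) where

  private
    n : ℕ
    n = suc n′

  coefficient : ℕ → ℕ → ℚ
  coefficient a b = (((+ a - + b) ℤ.* + b) ℤ.* + (a C b)) ℤ.* (+ (n * n) - + 1) / 24

  24*coefficient : ∀ a b → ι 24 ⊛ const (coefficient a b) ≋ ι (quadraticWeight a b) ⊛ (ι n ⊛ ι n ∖ one)
  24*coefficient a b = begin
    ι 24 ⊛ const (coefficient a b)
      -- For n = n′ + 1 the integer n² - 1 computes to the natural number `n′ + n′ * n`, and with
      -- `quadraticWeight-ℤ` the whole numerator is natural.
      ≡⟨ P.cong (λ z → ι 24 ⊛ const (z / 24))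
           (P.trans (P.cong (ℤ._* + (n′ ℕ.+ n′ * n)) (quadraticWeight-ℤ a b))
                    (P.sym (ℤₚ.pos-* (quadraticWeight a b) (n′ ℕ.+ n′ * n)))) ⟩
    ι 24 ⊛ const (+ (quadraticWeight a b * (n′ ℕ.+ n′ * n)) / 24)
      ≈⟨ ι-⊛-const 23 (+ (quadraticWeight a b * (n′ ℕ.+ n′ * n))) ⟩
    const (+ (quadraticWeight a b * (n′ ℕ.+ n′ * n)) / 1)
      ≈⟨ ι≋const (quadraticWeight a b * (n′ ℕ.+ n′ * n)) ⟨
    ι (quadraticWeight a b * (n′ ℕ.+ n′ * n))
      ≈⟨ ι-* (quadraticWeight a b) (n′ ℕ.+ n′ * n) ⟩
    ι (quadraticWeight a b) ⊛ ι (n′ ℕ.+ n′ * n)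
      ≈⟨ ⊛-congˡ (ι (quadraticWeight a b)) (solve 1 (λ m → m := (con (+ 1) :+ m) :- con (+ 1)) ≋-refl (ι (n′ ℕ.+ n′ * n))) ⟩
    ι (quadraticWeight a b) ⊛ ((one ⊕ ι (n′ ℕ.+ n′ * n)) ∖ one)
      ≈⟨ ⊛-congˡ (ι (quadraticWeight a b)) (⊕-cong (≋-trans (≋-sym (ι-suc (n′ ℕ.+ n′ * n))) (ι-* n n)) (≋-refl {neg one})) ⟩
    ι (quadraticWeight a b) ⊛ (ι n ⊛ ι n ∖ one) ∎

-- The leading `one` is `X^ 0`: the difference is a polynomial multiple of Φ³, so the power of q
-- that would clear negative exponents is trivial.
≋-replace : ∀ {f f′ g g′ x c e e′ : Poly} → f ≋ f′ → g ≋ g′ → e ≋ e′ →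
  f′ ∖ (g′ ∖ c ⊛ (e′ ⊛ e′)) ≋ x → one ⊛ (f ⊖ (g ⊖ c ⊛ (e ⊛ e))) ≋ x
≋-replace {c = c} f≋ g≋ e≋ eq = ≋-trans (⊛-identityˡ _)
  (≋-trans (⊕-cong f≋ (neg-cong (⊕-cong g≋ (neg-cong (⊛-congˡ c (⊛-cong e≋ e≋)))))) eq)

theorem5 : (n a b : ℕ) → 1 ≤ n →
    qbinom (a * n) (b * n)
    ≡ compose (qbinom a b) (X^ (n * n))
    ⊖ const ((((+ a - + b) Data.Integer.* + b) Data.Integer.* + (a C b))
    Data.Integer.* (+ (n * n) - + 1) / 24)
    ⊛ ((X^ n ⊖ one) ⊛ (X^ n ⊖ one))
    [mod Φ n ⊛ Φ n ⊛ Φ n ]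
theorem5 (suc n′) a b (s≤s z≤n) =
  let n = suc n′
      c = const (coefficient n′ a b)
      (h , e) = cyclotomic-ljunggren ι-invertible u-regular Φ-exact n′ a b c (24*coefficient n′ a b)
  in 0 , h , coeffs (≋-replace {c = c}
       (qbinom≋G (a * n) (b * n))
       (≋-trans (compose-cong (X^ (n * n)) (qbinom≋G a b))
         (≋-trans (compose-G (X^ (n * n)) a b) (G-cong (X^≋ (n * n)) a b)))
       (⊕-cong (X^≋ n) (≋-refl {neg one}))
       e)
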